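{- Let $q$ be a power of $2$. Both the minimum distance and the stopping distance of the binary code $\mathcal{C}(2,q)$ (with respect to the parity-check matrix $H(2,q)$) are $4q$.
   Context: $\mathbb{S}_2(\mathbb{F}_q)$ denotes the set of $2\times 2$ symmetric matrices over $\mathbb{F}_q$ (its elements are called points). Two points $S,S'$ are adjacent if $\operatorname{rank}(S-S')=1$. A line is a maximal set of rank $1$: a subset $\mathcal{M}\subseteq\mathbb{S}_2(\mathbb{F}_q)$ such that any two distinct points of $\mathcal{M}$ are adjacent and no point of $\mathbb{S}_2(\mathbb{F}_q)\setminus\mathcal{M}$ is adjacent to every point of $\mathcal{M}$. $H(2,q)$ is the binary matrix with rows indexed by the lines and columns indexed by the points, whose (line, point) entry is $1$ iff the point belongs to the line. $\mathcal{C}(2,q)=\{c\in\mathbb{F}_2^{\text{points}}: H(2,q)c=0\}$. A stopping set is a set $T$ of coordinate positions such that no row of $H(2,q)$ has exactly one $1$ among the positions in $T$; the stopping distance is the minimum size of a nonempty stopping set. -}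

module Defs where

open import Data.Nat using (ℕ; _≤_) renaming (_+_ to _+ℕ_)
open import Data.Fin using (Fin; _≟_)
open import Data.Bool using (Bool; true; false; _∧_; _xor_; if_then_else_)
open import Data.List using (List; allFin; cartesianProduct; map; foldr)
open import Data.Nat.ListAction using (sum)
open import Data.Product using (_×_; _,_; Σ; ∃; ∃-syntax)
open import Relation.Nullary using (¬_; yes; no)
open import Relation.Binary.PropositionalEquality using (_≡_)
open import Algebra.Core using (Op₁; Op₂)
open import Algebra.Structures using (IsCommutativeRing)

-- A (finite) field whose underlying set is Fin q (every finite field of order q
-- is isomorphic to one of this form).  Equality is propositional equality.
record FiniteField (q : ℕ) : Set where
  field
    _+_ _*_    : Op₂ (Fin q)
    -_         : Op₁ (Fin q)
    0# 1#      : Fin q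
    isCommutativeRing : IsCommutativeRing _≡_ _+_ _*_ -_ 0# 1#
    0≢1        : ¬ (0# ≡ 1#)
    inverse    : ∀ x → ¬ (x ≡ 0#) → ∃[ y ] (x * y ≡ 1#)

module SymmetricMatrices {q : ℕ} (F : FiniteField q) where
  open FiniteField F

  -- A point of S_2(F_q): the symmetric matrix [[a , b] , [b , c]] is (a , b , c).
  Point : Set
  Point = Fin q × Fin q × Fin q

  _-ₚ_ : Point → Point → Point
  (a , b , c) -ₚ (a' , b' , c') = (a + (- a')) , (b + (- b')) , (c + (- c'))

  det : Point → Fin q
  det (a , b , c) = (a * c) + (- (b * b))

  rank : Point → ℕ
  rank (a , b , c) with a ≟ 0# | b ≟ 0# | c ≟ 0#
  ... | yes _ | yes _ | yes _ = 0
  ... | _     | _     | _     with det (a , b , c) ≟ 0#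
  ...   | yes _ = 1
  ...   | no  _ = 2

  Adjacent : Point → Point → Set
  Adjacent S S' = rank (S -ₚ S') ≡ 1

  -- subsets of the point set, and binary vectors indexed by points
  Subset : Set
  Subset = Point → Bool

  IsLine : Subset → Set
  IsLine M =
      (∀ S S' → M S ≡ true → M S' ≡ true → ¬ (S ≡ S') → Adjacent S S')
    × (∀ P → M P ≡ false → ¬ (∀ S → M S ≡ true → Adjacent P S))

  allPoints : List Point
  allPoints = cartesianProduct (allFin q) (cartesianProduct (allFin q) (allFin q))

  size : Subset → ℕ
  size T = sum (map (λ p → if T p then 1 else 0) allPoints)

  parity : Subset → Bool
  parity T = foldr (λ p acc → T p xor acc) false allPoints

  -- C(2,q) = { c : H(2,q) c = 0 } : every row (line) meets c in an even number of 1s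
  InCode : Subset → Set
  InCode c = ∀ M → IsLine M → parity (λ p → M p ∧ c p) ≡ false

  NonEmpty : Subset → Set
  NonEmpty T = ∃[ p ] (T p ≡ true)

  -- minimum distance of the linear code = minimum weight of a nonzero codeword
  MinimumDistanceIs : ℕ → Set
  MinimumDistanceIs d =
      (Σ Subset λ c → InCode c × NonEmpty c × size c ≡ d)
    × (∀ c → InCode c → NonEmpty c → d ≤ size c)

  IsStoppingSet : Subset → Set
  IsStoppingSet T = ∀ M → IsLine M → ¬ (size (λ p → M p ∧ T p) ≡ 1)

  StoppingDistanceIs : ℕ → Set
  StoppingDistanceIs d =
      (Σ Subset λ T → IsStoppingSet T × NonEmpty T × size T ≡ d)
    × (∀ T → IsStoppingSet T → NonEmpty T → d ≤ size T)

{-# OPTIONS --safe #-}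
module Submission where

-- In characteristic 2 the form N(a,b,c) = ac + b² has polar form ac′ + a′c, so
-- points and lines form a generalized quadrangle W(q) with the perp of one point
-- removed, where u and v are collinear iff N(u + v) = 0.  It has no triangles and
-- its points are regular: with A = T ∩ {x,y}^⟂ and B = T ∩ {p,r}^⟂ for a
-- quadrangle p, x, r, y in a stopping set T, a point of T that is collinear with
-- two points of A lies in B, and conversely.  Let a = |A| and b = |B|.  Of the
-- q + 1 lines through a point of A, exactly b meet B; each of the others contains
-- a further point of T, and so for the points of B.  All these points are
-- distinct, hence |T| ≥ (a+b)(q+2) − 2ab, and this is at least 4q because
-- 2 ≤ a, b ≤ q.  If T contains no quadrangle, then the points at distance at most
-- two from a point of T already number (q+1)² ≥ 4q.
--
-- Equality holds for c ∈ {0,1}, a + b² ∈ {0,1}: every line is invariant under a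
-- translation that preserves this set and has no fixed point on it.

open import Defs
open import Level using (0ℓ)
open import Algebra.Bundles using (CommutativeRing; RawRing)
import Algebra.Properties.CommutativeMonoid.Sum as Sum
import Algebra.Properties.Group as GroupProperties
import Algebra.Properties.Ring as RingProperties
import Algebra.Properties.Semiring.Mult as Mult
import Algebra.Solver.Ring as RingSolver
open import Algebra.Solver.Ring.AlmostCommutativeRing
  using (_-Raw-AlmostCommutative⟶_; Induced-equivalence; fromCommutativeRing)
open import Data.Bool using (Bool; true; false; if_then_else_; _∧_; _∨_; _xor_; not)
import Data.Bool.Properties as Bool
open import Data.Empty using (⊥)
open import Data.Fin using (Fin; zero; suc; remQuot; combine)
import Data.Fin as Fin
open import Data.Fin.Permutation using (permutation)
import Data.Fin.Properties as Fin
open import Data.List using (List; []; _∷_; map; filter; length; lookup; foldr)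
open import Data.List.Membership.Propositional using (_∈_)
open import Data.List.Membership.Propositional.Properties
  using (∈-filter⁺; ∈-filter⁻; ∈-lookup; ∈-cartesianProduct⁺; ∈-allFin)
import Data.List.Membership.Setoid.Properties as SetoidMembership
open import Data.List.Properties using (map-cong)
open import Data.List.Relation.Unary.All using (_∷_)
import Data.List.Relation.Unary.All as All
open import Data.List.Relation.Unary.AllPairs using (_∷_)
open import Data.List.Relation.Unary.Any using (here; there; index)
import Data.List.Relation.Unary.Any as Any
open import Data.List.Relation.Unary.Unique.Propositional using (Unique)
open import Data.List.Relation.Unary.Unique.Propositional.Properties
  using (filter⁺; cartesianProduct⁺; allFin⁺)
open import Data.Maybe using (just; nothing)
open import Data.Nat using (ℕ; zero; suc; _+_; _*_; _^_; _≤_; _<_; z≤n; s≤s)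
import Data.Nat as ℕ
open import Data.Nat.ListAction using (sum)
import Data.Nat.Properties as ℕ
open import Data.Nat.Tactic.RingSolver using (solve-∀)
open import Data.Product using (_×_; _,_; proj₁; proj₂; ∃₂; ∃-syntax)
open import Data.Product.Properties using (≡-dec)
open import Data.Sum using (_⊎_; inj₁; inj₂)
open import Function using (_∘_; id; case_of_)
open import Function.Definitions using (Injective)
open import Relation.Binary.Definitions using (DecidableEquality; WeaklyDecidable)
open import Relation.Binary.PropositionalEquality
open import Relation.Nullary using (¬_; Dec; yes; no; does; contradiction)
open import Relation.Nullary.Decidable using (dec-true; dec-false)

-- Counting subsets of a type that has a duplicate-free enumeration.

lookup-injective : {A : Set} {xs : List A} → Unique xs → Injective _≡_ _≡_ (lookup xs)
lookup-injective (x∉ ∷ u) {Fin.zero}  {Fin.zero}  eq = refl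
lookup-injective (x∉ ∷ u) {Fin.zero}  {Fin.suc j} eq = contradiction eq (All.lookup x∉ (∈-lookup j))
lookup-injective (x∉ ∷ u) {Fin.suc i} {Fin.zero}  eq = contradiction (sym eq) (All.lookup x∉ (∈-lookup i))
lookup-injective (x∉ ∷ u) {Fin.suc i} {Fin.suc j} eq = cong Fin.suc (lookup-injective u eq)

module Counting {A : Set} (xs : List A) (unique : Unique xs) (complete : ∀ x → x ∈ xs) where

  ∑ : (A → ℕ) → ℕ
  ∑ F = sum (map F xs)

  ind : Bool → ℕ
  ind b = if b then 1 else 0

  count : (A → Bool) → ℕ
  count f = ∑ λ x → ind (f x)

  private
    sum-zero : ∀ (ys : List A) → sum (map (λ _ → 0) ys) ≡ 0
    sum-zero []       = refl
    sum-zero (_ ∷ ys) = sum-zero ys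

    sum-distrib-+ : ∀ (F G : A → ℕ) ys →
      sum (map (λ x → F x + G x) ys) ≡ sum (map F ys) + sum (map G ys)
    sum-distrib-+ F G []       = refl
    sum-distrib-+ F G (y ∷ ys) rewrite sum-distrib-+ F G ys =
      interchange (F y) (G y) (sum (map F ys)) (sum (map G ys))
      where
      interchange : ∀ a b c d → a + b + (c + d) ≡ a + c + (b + d)
      interchange = solve-∀

    sum-mono : ∀ {F G : A → ℕ} → (∀ x → F x ≤ G x) → ∀ ys → sum (map F ys) ≤ sum (map G ys)
    sum-mono F≤G []       = z≤n
    sum-mono F≤G (y ∷ ys) = ℕ.+-mono-≤ (F≤G y) (sum-mono F≤G ys)

    sum-*ʳ : ∀ (F : A → ℕ) k ys → sum (map (λ x → F x * k) ys) ≡ sum (map F ys) * k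
    sum-*ʳ F k []       = refl
    sum-*ʳ F k (y ∷ ys) rewrite sum-*ʳ F k ys = sym (ℕ.*-distribʳ-+ k (F y) (sum (map F ys)))

    sum-comm : ∀ (F : A → A → ℕ) ys zs →
      sum (map (λ y → sum (map (F y) zs)) ys) ≡ sum (map (λ z → sum (map (λ y → F y z) ys)) zs)
    sum-comm F []       zs = sym (sum-zero zs)
    sum-comm F (y ∷ ys) zs rewrite sum-comm F ys zs =
      sym (sum-distrib-+ (F y) (λ z → sum (map (λ w → F w z) ys)) zs)

    elements : (A → Bool) → List A
    elements f = filter (λ x → f x Bool.≟ true) xs

    sum≡length : ∀ (f : A → Bool) ys →
      sum (map (λ x → ind (f x)) ys) ≡ length (filter (λ x → f x Bool.≟ true) ys)
    sum≡length f []       = refl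
    sum≡length f (y ∷ ys) with f y
    ... | true  = cong suc (sum≡length f ys)
    ... | false = sum≡length f ys

    count≡length : ∀ f → count f ≡ length (elements f)
    count≡length f = sum≡length f xs

    elements-unique : ∀ f → Unique (elements f)
    elements-unique f = filter⁺ (λ x → f x Bool.≟ true) unique

    ∈-elements : ∀ f {x} → f x ≡ true → x ∈ elements f
    ∈-elements f {x} = ∈-filter⁺ (λ x → f x Bool.≟ true) (complete x)

    elements-true : ∀ f {x} → x ∈ elements f → f x ≡ true
    elements-true f = proj₂ ∘ ∈-filter⁻ (λ x → f x Bool.≟ true) {xs = xs}

  ∑-distrib-+ : ∀ F G → ∑ (λ x → F x + G x) ≡ ∑ F + ∑ G
  ∑-distrib-+ F G = sum-distrib-+ F G xs

  ∑-mono : ∀ {F G} → (∀ x → F x ≤ G x) → ∑ F ≤ ∑ G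
  ∑-mono F≤G = sum-mono F≤G xs

  ∑-cong : ∀ {F G} → (∀ x → F x ≡ G x) → ∑ F ≡ ∑ G
  ∑-cong F≗G = cong sum (map-cong F≗G xs)

  ∑-*ʳ : ∀ F k → ∑ (λ x → F x * k) ≡ ∑ F * k
  ∑-*ʳ F k = sum-*ʳ F k xs

  ∑-comm : ∀ (F : A → A → ℕ) → ∑ (λ x → ∑ (F x)) ≡ ∑ (λ y → ∑ λ x → F x y)
  ∑-comm F = sum-comm F xs xs

  search : ∀ (f : A → Bool) → (∃[ x ] f x ≡ true) ⊎ (∀ x → f x ≡ false)
  search f with Any.any? (λ x → f x Bool.≟ true) xs
  ... | yes any = inj₁ (Any.satisfied any)
  ... | no ¬any = inj₂ λ x → Bool.¬-not λ fx → ¬any (Any.map (λ { refl → fx }) (complete x))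

  collision : ∀ {k f} → count f < k → (c : Fin k → A) → (∀ i → f (c i) ≡ true) →
              ∃₂ λ i j → ¬ i ≡ j × c i ≡ c j
  collision {f = f} n<k c fc
    with i , j , i<j , eq ← Fin.pigeonhole (subst (_< _) (count≡length f) n<k)
                              (λ i → index (∈-elements f (fc i)))
    = i , j , Fin.<⇒≢ i<j
    , SetoidMembership.index-injective (setoid A) (∈-elements f (fc i)) (∈-elements f (fc j)) eq

  injective⇒≤count : ∀ {k f} (c : Fin k → A) → Injective _≡_ _≡_ c →
                     (∀ i → f (c i) ≡ true) → k ≤ count f
  injective⇒≤count c c-inj fc = ℕ.≮⇒≥ λ n<k →
    let i , j , i≢j , eq = collision n<k c fc in i≢j (c-inj eq)

  count≤Fin : ∀ {k} f (φ : A → Fin k) →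
              (∀ {x y} → f x ≡ true → f y ≡ true → φ x ≡ φ y → x ≡ y) → count f ≤ k
  count≤Fin f φ φ-inj = subst (_≤ _) (sym (count≡length f)) (Fin.injective⇒≤ {f = φ ∘ lookup (elements f)}
    λ {i} {j} eq → lookup-injective (elements-unique f)
      (φ-inj (elements-true f (∈-lookup i)) (elements-true f (∈-lookup j)) eq))

  count≤count : ∀ f g (φ : A → A) → (∀ {x y} → φ x ≡ φ y → x ≡ y) →
                (∀ {x} → f x ≡ true → g (φ x) ≡ true) → count f ≤ count g
  count≤count f g φ φ-inj f⇒g = subst (_≤ _) (sym (count≡length f))
    (injective⇒≤count (φ ∘ lookup (elements f))
      (λ {i} {j} eq → lookup-injective (elements-unique f) (φ-inj eq))
      (λ i → f⇒g (elements-true f (∈-lookup i))))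

  count-none : ∀ {f} → (∀ x → f x ≡ false) → count f ≡ 0
  count-none {f} f≡false =
    ℕ.n≤0⇒n≡0 (subst (count f ≤_) (sum-zero xs) (∑-mono λ x → ℕ.≤-reflexive (cong ind (f≡false x))))

  count-none⁻ : ∀ {f} → count f ≡ 0 → ∀ x → f x ≡ false
  count-none⁻ {f} count≡0 x = Bool.¬-not λ fx → ℕ.n≮0 (subst (1 ≤_) count≡0
    (injective⇒≤count {1} {f} (λ _ → x) (λ { {Fin.zero} {Fin.zero} _ → refl }) (λ _ → fx)))

  count≤1 : ∀ {f} → (∀ {x y} → f x ≡ true → f y ≡ true → x ≡ y) → count f ≤ 1
  count≤1 {f} f-inj = count≤Fin f (λ _ → Fin.zero) λ fx fy _ → f-inj fx fy

  count-mono : ∀ {f g} → (∀ {x} → f x ≡ true → g x ≡ true) → count f ≤ count g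
  count-mono {f} {g} = count≤count f g (λ x → x) (λ eq → eq)

  -- The form in which the stopping condition is used: a line that meets a stopping set meets it in
  -- a second point.
  another : ∀ f {x} → ¬ count f ≡ 1 → f x ≡ true → ∃[ y ] ¬ y ≡ x × f y ≡ true
  another f {x} ≢1 fx rewrite count≡length f
    with elements f | elements-unique f | ∈-elements f fx | (λ {y} → elements-true f {y})
  ... | _ ∷ []    | _                   | _          | _  = contradiction refl ≢1
  ... | _ ∷ y ∷ _ | (x≢y ∷ _) ∷ _       | here refl  | el =
    y , (λ y≡x → x≢y (sym y≡x)) , el (there (here refl))
  ... | z ∷ _ ∷ _ | z≢ ∷ _              | there x∈ys | el =
    z , (λ { refl → All.lookup z≢ x∈ys refl }) , el (here refl)

  odd : ℕ → Bool
  odd zero    = false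
  odd (suc n) = not (odd n)

  odd-double : ∀ k → odd (k + k) ≡ false
  odd-double zero    = refl
  odd-double (suc k) rewrite ℕ.+-suc k k | Bool.not-involutive (odd (k + k)) = odd-double k

  -- Turns parity checks into statements about cardinalities, so that evenness can be shown by
  -- counting and a count of 1 contradicts a check.
  foldr-xor≡odd : ∀ f → foldr (λ x acc → f x xor acc) false xs ≡ odd (count f)
  foldr-xor≡odd f = go xs
    where
    go : ∀ ys → foldr (λ x acc → f x xor acc) false ys ≡ odd (sum (map (λ x → ind (f x)) ys))
    go []       = refl
    go (y ∷ ys) with f y
    ... | true  = cong not (go ys)
    ... | false = go ys

-- Absence of zero divisors.

module FieldProperties {q : ℕ} (F : FiniteField q) where
  open FiniteField F public renaming (_+_ to infixl 6 _⊹_; _*_ to infixl 7 _·_)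

  commutativeRing : CommutativeRing 0ℓ 0ℓ
  commutativeRing = record { isCommutativeRing = isCommutativeRing }
  open CommutativeRing commutativeRing public
    using (+-comm; +-assoc; *-comm; *-assoc; +-identityˡ; +-identityʳ; *-identityˡ;
           zeroˡ; zeroʳ; -‿inverseˡ; -‿inverseʳ; ring)

  x·y≢0 : ∀ {x y} → ¬ x ≡ 0# → ¬ y ≡ 0# → ¬ x · y ≡ 0#
  x·y≢0 {x} {y} x≢0 y≢0 xy≡0 with inverse x x≢0
  ... | x⁻¹ , xx⁻¹≡1 = y≢0 (begin
    y              ≡⟨ *-identityˡ y ⟨
    1# · y         ≡⟨ cong (_· y) (trans (sym xx⁻¹≡1) (*-comm x x⁻¹)) ⟩
    x⁻¹ · x · y    ≡⟨ *-assoc x⁻¹ x y ⟩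
    x⁻¹ · (x · y)  ≡⟨ cong (x⁻¹ ·_) xy≡0 ⟩
    x⁻¹ · 0#       ≡⟨ zeroʳ x⁻¹ ⟩
    0#             ∎)
    where open ≡-Reasoning

  ·-cancelˡ-0 : ∀ {x y} → ¬ x ≡ 0# → x · y ≡ 0# → y ≡ 0#
  ·-cancelˡ-0 {x} {y} x≢0 xy≡0 with y Fin.≟ 0#
  ... | yes y≡0 = y≡0
  ... | no y≢0  = contradiction xy≡0 (x·y≢0 x≢0 y≢0)

  x·x≡0⇒x≡0 : ∀ {x} → x · x ≡ 0# → x ≡ 0#
  x·x≡0⇒x≡0 {x} xx≡0 with x Fin.≟ 0#
  ... | yes x≡0 = x≡0
  ... | no x≢0  = ·-cancelˡ-0 x≢0 xx≡0

Characteristic2 : ∀ {q} → FiniteField q → Set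
Characteristic2 F = 1# ⊹ 1# ≡ 0#
  where open FiniteField F renaming (_+_ to _⊹_)

-- Symmetric matrices in characteristic 2.

module Geometry {q : ℕ} (F : FiniteField q) (1+1≡0 : Characteristic2 F) where

  open FieldProperties F public
  open SymmetricMatrices F public
  open RingProperties ring using (+-inverseˡ-unique)

  𝔽₂ : RawRing 0ℓ 0ℓ
  𝔽₂ = record { Carrier = Bool ; _≈_ = _≡_ ; _+_ = _xor_ ; _*_ = _∧_ ; -_ = id ; 0# = false ; 1# = true }

  1≡-1 : 1# ≡ - 1#
  1≡-1 = +-inverseˡ-unique 1# 1# 1+1≡0

  morphism : 𝔽₂ -Raw-AlmostCommutative⟶ fromCommutativeRing commutativeRing
  morphism = record
    { ⟦_⟧    = ⟦_⟧
    ; +-homo = λ { true true → sym 1+1≡0 ; true false → sym (+-identityʳ 1#) ; false b → sym (+-identityˡ ⟦ b ⟧) }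
    ; *-homo = λ { true b → sym (*-identityˡ ⟦ b ⟧) ; false b → sym (zeroˡ ⟦ b ⟧) }
    ; -‿homo = λ { true → 1≡-1 ; false → +-inverseˡ-unique 0# 0# (+-identityˡ 0#) }
    ; 0-homo = refl
    ; 1-homo = refl
    }
    where
    ⟦_⟧ : Bool → Fin q
    ⟦ true ⟧  = 1#
    ⟦ false ⟧ = 0#

  _≟𝔽₂_ : WeaklyDecidable (Induced-equivalence morphism)
  true  ≟𝔽₂ true  = just refl
  false ≟𝔽₂ false = just refl
  _     ≟𝔽₂ _     = nothing

  -- The coefficients live in 𝔽₂, so the solver knows that 2 = 0.
  open RingSolver 𝔽₂ (fromCommutativeRing commutativeRing) morphism _≟𝔽₂_
    using (solve; _:+_; _:*_; _:=_; con; Polynomial) public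

  x+x≡0 : ∀ x → x ⊹ x ≡ 0#
  x+x≡0 = solve 1 (λ x → x :+ x := con false) refl

  -x≡x : ∀ x → - x ≡ x
  -x≡x x = sym (+-inverseˡ-unique x x (x+x≡0 x))

  x+y≡0⇒x≡y : ∀ {x y} → x ⊹ y ≡ 0# → x ≡ y
  x+y≡0⇒x≡y {x} {y} eq = trans (+-inverseˡ-unique x y eq) (-x≡x y)

  -- Translations, the quadratic form and collinearity.

  infixl 6 _⊕_
  _⊕_ : Point → Point → Point
  (a , b , c) ⊕ (a′ , b′ , c′) = a ⊹ a′ , b ⊹ b′ , c ⊹ c′

  𝟘 : Point
  𝟘 = 0# , 0# , 0#

  N : Point → Fin q
  N (a , b , c) = a · c ⊹ b · b

  -- The polar form of N (the term 2bb′ vanishes in characteristic 2).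
  B : Point → Point → Fin q
  B (a , _ , c) (a′ , _ , c′) = a · c′ ⊹ a′ · c

  D : Point → Point → Fin q
  D u v = N (u ⊕ v)

  _⟂_ : Point → Point → Set
  u ⟂ v = D u v ≡ 0#

  -ₚ≡⊕ : ∀ u v → u -ₚ v ≡ u ⊕ v
  -ₚ≡⊕ (a , b , c) (a′ , b′ , c′) rewrite -x≡x a′ | -x≡x b′ | -x≡x c′ = refl

  point≡ : ∀ {a b c a′ b′ c′ : Fin q} → a ≡ a′ → b ≡ b′ → c ≡ c′ → (a , b , c) ≡ (a′ , b′ , c′)
  point≡ refl refl refl = refl

  point-injective : ∀ {a b c a′ b′ c′ : Fin q} → (a , b , c) ≡ (a′ , b′ , c′) → a ≡ a′ × b ≡ b′ × c ≡ c′
  point-injective refl = refl , refl , refl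

  ⊕-comm : ∀ u v → u ⊕ v ≡ v ⊕ u
  ⊕-comm (a , b , c) (a′ , b′ , c′) = point≡ (+-comm a a′) (+-comm b b′) (+-comm c c′)

  ⊕-assoc : ∀ u v w → u ⊕ v ⊕ w ≡ u ⊕ (v ⊕ w)
  ⊕-assoc (a , b , c) (a′ , b′ , c′) (a″ , b″ , c″) =
    point≡ (+-assoc a a′ a″) (+-assoc b b′ b″) (+-assoc c c′ c″)

  u⊕u≡𝟘 : ∀ u → u ⊕ u ≡ 𝟘
  u⊕u≡𝟘 (a , b , c) = point≡ (x+x≡0 a) (x+x≡0 b) (x+x≡0 c)

  u⊕𝟘≡u : ∀ u → u ⊕ 𝟘 ≡ u
  u⊕𝟘≡u (a , b , c) = point≡ (+-identityʳ a) (+-identityʳ b) (+-identityʳ c)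

  u⊕v⊕v≡u : ∀ u v → u ⊕ v ⊕ v ≡ u
  u⊕v⊕v≡u u v = trans (⊕-assoc u v v) (trans (cong (u ⊕_) (u⊕u≡𝟘 v)) (u⊕𝟘≡u u))

  u⊕[u⊕v]≡v : ∀ u v → u ⊕ (u ⊕ v) ≡ v
  u⊕[u⊕v]≡v u v = trans (⊕-comm u (u ⊕ v)) (trans (cong (_⊕ u) (⊕-comm u v)) (u⊕v⊕v≡u v u))

  ⊕-cancelʳ : ∀ {u v} w → u ⊕ w ≡ v ⊕ w → u ≡ v
  ⊕-cancelʳ {u} {v} w eq = trans (sym (u⊕v⊕v≡u u w)) (trans (cong (_⊕ w) eq) (u⊕v⊕v≡u v w))

  u⊕v≡𝟘⇒u≡v : ∀ {u v} → u ⊕ v ≡ 𝟘 → u ≡ v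
  u⊕v≡𝟘⇒u≡v {u} {v} eq = ⊕-cancelʳ v (trans eq (sym (u⊕u≡𝟘 v)))

  N-⊕ : ∀ u v → N (u ⊕ v) ≡ N u ⊹ N v ⊹ B u v
  N-⊕ (a , b , c) (a′ , b′ , c′) =
    solve 6 (λ a b c a′ b′ c′ → (a :+ a′) :* (c :+ c′) :+ (b :+ b′) :* (b :+ b′) :=
      a :* c :+ b :* b :+ (a′ :* c′ :+ b′ :* b′) :+ (a :* c′ :+ a′ :* c)) refl a b c a′ b′ c′

  N-𝟘 : N 𝟘 ≡ 0#
  N-𝟘 = solve 0 (con false :* con false :+ con false :* con false := con false) refl

  ⟂-refl : ∀ u → u ⟂ u
  ⟂-refl u = trans (cong N (u⊕u≡𝟘 u)) N-𝟘

  ⟂-sym : ∀ {u v} → u ⟂ v → v ⟂ u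
  ⟂-sym {u} {v} eq = trans (cong N (⊕-comm v u)) eq

  B-vertical : ∀ u v → proj₁ v ≡ 0# → proj₂ (proj₂ v) ≡ 0# → B u v ≡ 0#
  B-vertical (a , _ , c) (_ , _ , _) a′≡0 c′≡0 = trans (cong₂ (λ a′ c′ → a · c′ ⊹ a′ · c) a′≡0 c′≡0)
    (solve 2 (λ a c → a :* con false :+ con false :* c := con false) refl a c)

  D-origin : ∀ p u v → D u v ≡ N (u ⊕ p) ⊹ N (v ⊕ p) ⊹ B (u ⊕ p) (v ⊕ p)
  D-origin p u v = trans (cong N (sym uppv)) (N-⊕ (u ⊕ p) (v ⊕ p))
    where
    uppv : (u ⊕ p) ⊕ (v ⊕ p) ≡ u ⊕ v
    uppv = trans (⊕-assoc u p (v ⊕ p)) (cong (u ⊕_) (trans (cong (p ⊕_) (⊕-comm v p)) (u⊕[u⊕v]≡v p v)))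

  -- `B` is the 2×2 determinant of the diagonal parts (a, c), so this is the three-term
  -- Grassmann-Plücker relation, whose signs disappear in characteristic 2.
  Plücker : ∀ u v w z → B u v · B w z ⊹ B u w · B v z ⊹ B u z · B v w ≡ 0#
  Plücker (a₁ , _ , c₁) (a₂ , _ , c₂) (a₃ , _ , c₃) (a₄ , _ , c₄) =
    solve 8 (λ a₁ a₂ a₃ a₄ c₁ c₂ c₃ c₄ →
      let ω : ∀ {n} (a c a′ c′ : Polynomial n) → Polynomial n
          ω a c a′ c′ = a :* c′ :+ a′ :* c in
      ω a₁ c₁ a₂ c₂ :* ω a₃ c₃ a₄ c₄ :+ ω a₁ c₁ a₃ c₃ :* ω a₂ c₂ a₄ c₄
        :+ ω a₁ c₁ a₄ c₄ :* ω a₂ c₂ a₃ c₃ := con false) refl a₁ a₂ a₃ a₄ c₁ c₂ c₃ c₄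

  N≡0⇒≡𝟘 : ∀ {b} a c → a ≡ 0# → c ≡ 0# → N (a , b , c) ≡ 0# → (a , b , c) ≡ 𝟘
  N≡0⇒≡𝟘 {b} a c refl refl N≡0 = point≡ refl (x·x≡0⇒x≡0 (trans (solve 1 (λ b →
    b :* b := con false :* con false :+ b :* b) refl b) N≡0)) refl

  -- An isotropic e ≠ 0 has a nonzero diagonal part, since N e = b² when a = c = 0. The diagonal
  -- parts of s and t are then both multiples of that of e, so their determinant vanishes.
  isotropic-B : ∀ {e s t} → ¬ e ≡ 𝟘 → N e ≡ 0# → B s e ≡ 0# → B t e ≡ 0# → B s t ≡ 0#
  isotropic-B {e@(a , b , c)} {s@(a₁ , b₁ , c₁)} {t@(a₂ , b₂ , c₂)} e≢𝟘 Ne Bse Bte with a Fin.≟ 0# | c Fin.≟ 0#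
  ... | yes a≡0 | yes c≡0 = contradiction (N≡0⇒≡𝟘 a c a≡0 c≡0 Ne) e≢𝟘
  ... | no a≢0  | _       = ·-cancelˡ-0 a≢0 (begin
    a · B s t                  ≡⟨ solve 6 (λ a c a₁ c₁ a₂ c₂ → a :* (a₁ :* c₂ :+ a₂ :* c₁) :=
                                    a₁ :* (a₂ :* c :+ a :* c₂) :+ a₂ :* (a₁ :* c :+ a :* c₁)) refl a c a₁ c₁ a₂ c₂ ⟩
    a₁ · B t e ⊹ a₂ · B s e    ≡⟨ cong₂ (λ x y → a₁ · x ⊹ a₂ · y) Bte Bse ⟩
    a₁ · 0# ⊹ a₂ · 0#          ≡⟨ solve 2 (λ x y → x :* con false :+ y :* con false := con false) refl a₁ a₂ ⟩
    0#                         ∎)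
    where open ≡-Reasoning
  ... | yes _   | no c≢0  = ·-cancelˡ-0 c≢0 (begin
    c · B s t                  ≡⟨ solve 6 (λ a c a₁ c₁ a₂ c₂ → c :* (a₁ :* c₂ :+ a₂ :* c₁) :=
                                    c₁ :* (a₂ :* c :+ a :* c₂) :+ c₂ :* (a₁ :* c :+ a :* c₁)) refl a c a₁ c₁ a₂ c₂ ⟩
    c₁ · B t e ⊹ c₂ · B s e    ≡⟨ cong₂ (λ x y → c₁ · x ⊹ c₂ · y) Bte Bse ⟩
    c₁ · 0# ⊹ c₂ · 0#          ≡⟨ solve 2 (λ x y → x :* con false :+ y :* con false := con false) refl c₁ c₂ ⟩
    0#                         ∎)
    where open ≡-Reasoning

  -- With the origin moved to p, the quadratic condition u ⟂ v becomes linear in u for neighbours u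
  -- of p, because the term N (u ⊕ p) drops out.
  ⟂⇒B : ∀ p {u v} → u ⟂ v → N (u ⊕ p) ≡ 0# → B (u ⊕ p) (v ⊕ p) ≡ N (v ⊕ p)
  ⟂⇒B p {u} {v} u⟂v Nu = sym (x+y≡0⇒x≡y (begin
    N (v ⊕ p) ⊹ B (u ⊕ p) (v ⊕ p)                ≡⟨ cong (_⊹ B (u ⊕ p) (v ⊕ p)) (+-identityˡ (N (v ⊕ p))) ⟨
    0# ⊹ N (v ⊕ p) ⊹ B (u ⊕ p) (v ⊕ p)           ≡⟨ cong (λ x → x ⊹ N (v ⊕ p) ⊹ B (u ⊕ p) (v ⊕ p)) Nu ⟨
    N (u ⊕ p) ⊹ N (v ⊕ p) ⊹ B (u ⊕ p) (v ⊕ p)    ≡⟨ D-origin p u v ⟨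
    D u v                                        ≡⟨ u⟂v ⟩
    0#                                           ∎))
    where open ≡-Reasoning

  B⇒⟂ : ∀ p {u v} → N (u ⊕ p) ≡ 0# → B (u ⊕ p) (v ⊕ p) ≡ N (v ⊕ p) → u ⟂ v
  B⇒⟂ p {u} {v} Nu Buv = trans (D-origin p u v) (trans (cong₂ (λ x y → x ⊹ N (v ⊕ p) ⊹ y) Nu Buv)
    (trans (cong (_⊹ N (v ⊕ p)) (+-identityˡ _)) (x+x≡0 _)))

  -- With the origin at u, both s and t are orthogonal to the isotropic vector v ⊕ u, hence to each
  -- other. This excludes triangles and makes the perp of a collinear pair a clique.
  collinear : ∀ {u v s t} → ¬ u ≡ v → u ⟂ v → s ⟂ u → s ⟂ v → t ⟂ u → t ⟂ v → s ⟂ t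
  collinear {u} {v} {s} {t} u≢v u⟂v s⟂u s⟂v t⟂u t⟂v = B⇒⟂ u s⟂u (trans
    (isotropic-B {v ⊕ u} {s ⊕ u} {t ⊕ u} (λ eq → u≢v (sym (u⊕v≡𝟘⇒u≡v eq))) Nvu
      (trans (⟂⇒B u s⟂v s⟂u) Nvu) (trans (⟂⇒B u t⟂v t⟂u) Nvu)) (sym t⟂u))
    where
    Nvu : N (v ⊕ u) ≡ 0#
    Nvu = ⟂-sym u⟂v

  -- With the origin at p, the first Plücker relation shows that r and z are
  -- proportional up to their middle entries, the second one transfers this to w.
  regular : ∀ {p r x y z w} → ¬ p ⟂ r → ¬ x ⟂ y → x ⟂ p → x ⟂ r → x ⟂ z → y ⟂ p → y ⟂ r → y ⟂ z →
            w ⟂ p → w ⟂ r → w ⟂ z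
  regular {p} {r} {x} {y} {z} {w} p⟂̸r x⟂̸y x⟂p x⟂r x⟂z y⟂p y⟂r y⟂z w⟂p w⟂r = B⇒⟂ p w⟂p BWZ
    where
    open ≡-Reasoning
    X Y R Z W : Point
    X = x ⊕ p
    Y = y ⊕ p
    R = r ⊕ p
    Z = z ⊕ p
    W = w ⊕ p
    NR≢0 : ¬ N R ≡ 0#
    NR≢0 eq = p⟂̸r (⟂-sym eq)
    BXY≢0 : ¬ B X Y ≡ 0#
    BXY≢0 eq = x⟂̸y (B⇒⟂ p x⟂p (trans eq (sym y⟂p)))
    BRZ : B R Z ≡ 0#
    BRZ = ·-cancelˡ-0 BXY≢0 (begin
      B X Y · B R Z                                   ≡⟨ +-identityʳ _ ⟨
      B X Y · B R Z ⊹ 0#                              ≡⟨ cong (B X Y · B R Z ⊹_) (x+x≡0 (N R · N Z)) ⟨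
      B X Y · B R Z ⊹ (N R · N Z ⊹ N R · N Z)         ≡⟨ +-assoc _ _ _ ⟨
      B X Y · B R Z ⊹ N R · N Z ⊹ N R · N Z           ≡⟨ cong₂ (λ s t → B X Y · B R Z ⊹ s ⊹ t)
        (cong₂ _·_ (⟂⇒B p x⟂r x⟂p) (⟂⇒B p y⟂z y⟂p))
        (trans (cong₂ _·_ (⟂⇒B p x⟂z x⟂p) (⟂⇒B p y⟂r y⟂p)) (*-comm (N Z) (N R))) ⟨
      B X Y · B R Z ⊹ B X R · B Y Z ⊹ B X Z · B Y R   ≡⟨ Plücker X Y R Z ⟩
      0#                                              ∎)
    BWZ : B W Z ≡ N Z
    BWZ = x+y≡0⇒x≡y (·-cancelˡ-0 NR≢0 (begin
      N R · (B W Z ⊹ N Z)                             ≡⟨ solve 4 (λ n m s t →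
        n :* (s :+ m) := t :* con false :+ n :* m :+ s :* n) refl (N R) (N Z) (B W Z) (B W X) ⟩
      B W X · 0# ⊹ N R · N Z ⊹ B W Z · N R            ≡⟨ cong₂ _⊹_ (cong₂ _⊹_ (cong (B W X ·_) BRZ)
        (cong₂ _·_ (⟂⇒B p w⟂r w⟂p) (⟂⇒B p x⟂z x⟂p))) (cong (B W Z ·_) (⟂⇒B p x⟂r x⟂p)) ⟨
      B W X · B R Z ⊹ B W R · B X Z ⊹ B W Z · B X R   ≡⟨ Plücker W X R Z ⟩
      0#                                              ∎))

  -- If u and v were collinear, x and y would both lie on the line through them.
  noncollinear : ∀ {x y u v} → ¬ x ⟂ y → ¬ u ≡ v → u ⟂ x → u ⟂ y → v ⟂ x → v ⟂ y → ¬ u ⟂ v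
  noncollinear x⟂̸y u≢v u⟂x u⟂y v⟂x v⟂y u⟂v =
    x⟂̸y (collinear u≢v u⟂v (⟂-sym u⟂x) (⟂-sym v⟂x) (⟂-sym u⟂y) (⟂-sym v⟂y))

  -- Squaring is additive and injective in characteristic 2, so the diagonal and the value of `N`
  -- determine the middle entry.
  diagonal≡⇒≡ : ∀ {b b′} a c → N (a , b , c) ≡ N (a , b′ , c) → (a , b , c) ≡ (a , b′ , c)
  diagonal≡⇒≡ {b} {b′} a c eq = point≡ refl (x+y≡0⇒x≡y (x·x≡0⇒x≡0 (begin
    (b ⊹ b′) · (b ⊹ b′)               ≡⟨ solve 4 (λ a b b′ c → (b :+ b′) :* (b :+ b′) :=
                                           a :* c :+ b :* b :+ (a :* c :+ b′ :* b′)) refl a b b′ c ⟩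
    N (a , b , c) ⊹ N (a , b′ , c)    ≡⟨ cong (_⊹ N (a , b′ , c)) eq ⟩
    N (a , b′ , c) ⊹ N (a , b′ , c)   ≡⟨ x+x≡0 (N (a , b′ , c)) ⟩
    0#                                ∎))) refl
    where open ≡-Reasoning

  ·-cancelʳ : ∀ {x y z} → ¬ z ≡ 0# → x · z ≡ y · z → x ≡ y
  ·-cancelʳ {x} {y} {z} z≢0 eq = x+y≡0⇒x≡y (·-cancelˡ-0 z≢0 (begin
    z · (x ⊹ y)      ≡⟨ solve 3 (λ x y z → z :* (x :+ y) := x :* z :+ y :* z) refl x y z ⟩
    x · z ⊹ y · z    ≡⟨ cong (_⊹ y · z) eq ⟩
    y · z ⊹ y · z    ≡⟨ x+x≡0 (y · z) ⟩
    0#               ∎))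
    where open ≡-Reasoning

  +-cancelʳ : ∀ {x y} z → x ⊹ z ≡ y ⊹ z → x ≡ y
  +-cancelʳ {x} {y} z eq = trans (sym (x+z+z x)) (trans (cong (_⊹ z) eq) (x+z+z y))
    where
    x+z+z : ∀ x → x ⊹ z ⊹ z ≡ x
    x+z+z x = solve 2 (λ x z → x :+ z :+ z := x) refl x z

  +-cancelˡ : ∀ {x y} z → z ⊹ x ≡ z ⊹ y → x ≡ y
  +-cancelˡ {x} {y} z eq = +-cancelʳ z (trans (+-comm x z) (trans eq (+-comm z y)))

  entry₁₁ entry₂₂ : Point → Fin q
  entry₁₁ (a , _ , _) = a
  entry₂₂ (_ , _ , c) = c

  -- The linear equation given by `B` can be solved for the first entry once the last is known, as
  -- c″ ≠ 0; then N = 0 determines the middle entry.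
  tangent-entry₂₂ : ∀ {Z W R} → N Z ≡ 0# → N W ≡ 0# → B Z R ≡ B W R → ¬ entry₂₂ R ≡ 0# →
                    entry₂₂ Z ≡ entry₂₂ W → Z ≡ W
  tangent-entry₂₂ {a , b , c} {a′ , b′ , .c} {a″ , _ , c″} NZ NW BZR≡BWR c″≢0 refl
    with refl ← ·-cancelʳ c″≢0 (+-cancelʳ (a″ · c) BZR≡BWR) = diagonal≡⇒≡ a c (trans NZ (sym NW))

  tangent-entry₁₁ : ∀ {Z W R} → N Z ≡ 0# → N W ≡ 0# → B Z R ≡ B W R → ¬ entry₁₁ R ≡ 0# →
                    entry₁₁ Z ≡ entry₁₁ W → Z ≡ W
  tangent-entry₁₁ {a , b , c} {.a , b′ , c′} {a″ , _ , c″} NZ NW BZR≡BWR a″≢0 refl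
    with refl ← ·-cancelʳ a″≢0 (trans (*-comm c a″) (trans (+-cancelˡ (a · c″) BZR≡BWR) (*-comm a″ c′)))
    = diagonal≡⇒≡ a c (trans NZ (sym NW))

  -- Directions and the lines through a point.

  -- The matrices of rank one up to scalar multiples.
  dir : Fin (suc q) → Point
  dir zero    = 0# , 0# , 1#
  dir (suc u) = 1# , u , u · u

  N-dir : ∀ i → N (dir i) ≡ 0#
  N-dir zero    = solve 0 (con false :* con true :+ con false :* con false := con false) refl
  N-dir (suc u) = solve 1 (λ u → con true :* (u :* u) :+ u :* u := con false) refl u

  dir≢𝟘 : ∀ i → ¬ dir i ≡ 𝟘
  dir≢𝟘 zero    eq = 0≢1 (sym (proj₂ (proj₂ (point-injective eq))))
  dir≢𝟘 (suc u) eq = 0≢1 (sym (proj₁ (point-injective eq)))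

  -- The form takes the value 1 between `dir zero` and any other direction, and (u + v)² between
  -- `dir (suc u)` and `dir (suc v)`.
  B-dir-injective : ∀ i j → B (dir i) (dir j) ≡ 0# → i ≡ j
  B-dir-injective zero    zero    _  = refl
  B-dir-injective zero    (suc v) eq = contradiction (sym (trans (solve 1 (λ v →
    con true := con false :* (v :* v) :+ con true :* con true) refl v) eq)) 0≢1
  B-dir-injective (suc u) zero    eq = contradiction (sym (trans (solve 1 (λ u →
    con true := con true :* con true :+ con false :* (u :* u)) refl u) eq)) 0≢1
  B-dir-injective (suc u) (suc v) eq = cong suc (x+y≡0⇒x≡y (x·x≡0⇒x≡0 (trans (solve 2 (λ u v →
    (u :+ v) :* (u :+ v) := con true :* (v :* v) :+ con true :* (u :* u)) refl u v) eq)))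

  -- A line is encoded as the perp of two of its points, p and p ⊕ dir i.
  OnLine : Point → Fin (suc q) → Point → Set
  OnLine p i z = z ⟂ p × z ⟂ (p ⊕ dir i)

  p⊕dir⊕p≡dir : ∀ p i → p ⊕ dir i ⊕ p ≡ dir i
  p⊕dir⊕p≡dir p i = trans (⊕-comm (p ⊕ dir i) p) (u⊕[u⊕v]≡v p (dir i))

  p⊕dir⟂p : ∀ p i → (p ⊕ dir i) ⟂ p
  p⊕dir⟂p p i = trans (cong N (p⊕dir⊕p≡dir p i)) (N-dir i)

  p≢p⊕dir : ∀ p i → ¬ p ≡ p ⊕ dir i
  p≢p⊕dir p i eq = dir≢𝟘 i (trans (sym (p⊕dir⊕p≡dir p i)) (trans (cong (_⊕ p) (sym eq)) (u⊕u≡𝟘 p)))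

  -- The points p ⊕ dir i and p ⊕ dir j both lie on the line through p and z, so they are collinear;
  -- this makes the two directions orthogonal, hence equal.
  OnLine-unique : ∀ {p z i j} → ¬ z ≡ p → OnLine p i z → OnLine p j z → i ≡ j
  OnLine-unique {p} {z} {i} {j} z≢p (z⟂p , z⟂pi) (_ , z⟂pj) = B-dir-injective i j (begin
    B (dir i) (dir j)                          ≡⟨ cong₂ B (p⊕dir⊕p≡dir p i) (p⊕dir⊕p≡dir p j) ⟨
    B (p ⊕ dir i ⊕ p) (p ⊕ dir j ⊕ p)          ≡⟨ ⟂⇒B p (collinear z≢p z⟂p
      (⟂-sym z⟂pi) (p⊕dir⟂p p i) (⟂-sym z⟂pj) (p⊕dir⟂p p j)) (p⊕dir⟂p p i) ⟩
    N (p ⊕ dir j ⊕ p)                          ≡⟨ p⊕dir⟂p p j ⟩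
    0#                                         ∎)
    where open ≡-Reasoning

  OnLine-sym : ∀ {p i z} → OnLine p i z → OnLine z i p
  OnLine-sym {p} {i} {z} (z⟂p , z⟂pi) = ⟂-sym z⟂p , trans (cong N (begin
    p ⊕ (z ⊕ dir i)  ≡⟨ ⊕-assoc p z (dir i) ⟨
    p ⊕ z ⊕ dir i    ≡⟨ cong (_⊕ dir i) (⊕-comm p z) ⟩
    z ⊕ p ⊕ dir i    ≡⟨ ⊕-assoc z p (dir i) ⟩
    z ⊕ (p ⊕ dir i)  ∎)) z⟂pi
    where open ≡-Reasoning

  OnLine-extend : ∀ {p i z w} → ¬ p ≡ z → OnLine p i z → w ⟂ p → w ⟂ z → OnLine p i w
  OnLine-extend {p} {i} p≢z (z⟂p , z⟂pi) w⟂p w⟂z =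
    w⟂p , collinear p≢z (⟂-sym z⟂p) w⟂p w⟂z (p⊕dir⟂p p i) (⟂-sym z⟂pi)

  _≟ₚ_ : DecidableEquality Point
  _≟ₚ_ = ≡-dec Fin._≟_ (≡-dec Fin._≟_ Fin._≟_)

  _⟂?_ : ∀ u v → Dec (u ⟂ v)
  u ⟂? v = D u v Fin.≟ 0#

  -- Adjacency as vanishing of the form, and lines as perps of collinear pairs.

  rank≡1⇒det≡0 : ∀ P → rank P ≡ 1 → det P ≡ 0#
  rank≡1⇒det≡0 (a , b , c) eq with det (a , b , c) Fin.≟ 0#
  ... | yes d = d
  ... | no ¬d with a Fin.≟ 0# | b Fin.≟ 0# | c Fin.≟ 0#
  rank≡1⇒det≡0 (a , b , c) eq | no ¬d | yes _ | yes _ | no _ with (a · c) ⊹ (- (b · b)) Fin.≟ 0#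
  ... | yes d = d
  rank≡1⇒det≡0 (a , b , c) eq | no ¬d | yes _ | no _  | _    with (a · c) ⊹ (- (b · b)) Fin.≟ 0#
  ... | yes d = d
  rank≡1⇒det≡0 (a , b , c) eq | no ¬d | no _  | _     | _    with (a · c) ⊹ (- (b · b)) Fin.≟ 0#
  ... | yes d = d

  det≡0⇒rank≡1 : ∀ P → ¬ P ≡ 𝟘 → det P ≡ 0# → rank P ≡ 1
  det≡0⇒rank≡1 (a , b , c) P≢𝟘 d with a Fin.≟ 0# | b Fin.≟ 0# | c Fin.≟ 0#
  ... | yes refl | yes refl | yes refl = contradiction refl P≢𝟘
  det≡0⇒rank≡1 (a , b , c) P≢𝟘 d | yes _ | yes _ | no _ with (a · c) ⊹ (- (b · b)) Fin.≟ 0#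
  ... | yes _ = refl
  ... | no ¬d = contradiction d ¬d
  det≡0⇒rank≡1 (a , b , c) P≢𝟘 d | yes _ | no _  | _    with (a · c) ⊹ (- (b · b)) Fin.≟ 0#
  ... | yes _ = refl
  ... | no ¬d = contradiction d ¬d
  det≡0⇒rank≡1 (a , b , c) P≢𝟘 d | no _  | _     | _    with (a · c) ⊹ (- (b · b)) Fin.≟ 0#
  ... | yes _ = refl
  ... | no ¬d = contradiction d ¬d

  det≡N : ∀ P → det P ≡ N P
  det≡N (a , b , c) = cong (a · c ⊹_) (-x≡x (b · b))

  adjacent⇒⟂ : ∀ {u v} → Adjacent u v → u ⟂ v
  adjacent⇒⟂ {u} {v} adj = trans (sym (det≡N (u ⊕ v)))
    (rank≡1⇒det≡0 (u ⊕ v) (subst (λ P → rank P ≡ 1) (-ₚ≡⊕ u v) adj))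

  ⟂⇒adjacent : ∀ {u v} → ¬ u ≡ v → u ⟂ v → Adjacent u v
  ⟂⇒adjacent {u} {v} u≢v u⟂v = subst (λ P → rank P ≡ 1) (sym (-ₚ≡⊕ u v))
    (det≡0⇒rank≡1 (u ⊕ v) (u≢v ∘ u⊕v≡𝟘⇒u≡v) (trans (det≡N (u ⊕ v)) u⟂v))

  -- The opaque blocks keep `with` from normalising enumerations and solver proofs.
  opaque
    allPoints-unique : Unique allPoints
    allPoints-unique = cartesianProduct⁺ (allFin⁺ q) (cartesianProduct⁺ (allFin⁺ q) (allFin⁺ q))

    ∈-allPoints : ∀ p → p ∈ allPoints
    ∈-allPoints (a , b , c) = ∈-cartesianProduct⁺ (∈-allFin a) (∈-cartesianProduct⁺ (∈-allFin b) (∈-allFin c))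

  open Counting allPoints allPoints-unique ∈-allPoints public

  does-true : ∀ {P : Set} (P? : Dec P) → does P? ≡ true → P
  does-true (yes p) _ = p

  ∧-true⁻ : ∀ {x y} → x ∧ y ≡ true → x ≡ true × y ≡ true
  ∧-true⁻ {true} {true} _ = refl , refl

  opaque
    perp : Point → Point → Subset
    perp u v z = does (z ⟂? u) ∧ does (z ⟂? v)

    perp⁻ : ∀ {u v z} → perp u v z ≡ true → z ⟂ u × z ⟂ v
    perp⁻ {u} {v} {z} eq = does-true (z ⟂? u) (proj₁ (∧-true⁻ eq)) , does-true (z ⟂? v) (proj₂ (∧-true⁻ eq))

    perp⁺ : ∀ {u v z} → z ⟂ u → z ⟂ v → perp u v z ≡ true
    perp⁺ {u} {v} {z} z⟂u z⟂v = cong₂ _∧_ (dec-true (z ⟂? u) z⟂u) (dec-true (z ⟂? v) z⟂v)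

  false≢true : ∀ {x} → x ≡ false → x ≡ true → ⊥
  false≢true refl ()

  perp-IsLine : ∀ {u v} → ¬ u ≡ v → u ⟂ v → IsLine (perp u v)
  perp-IsLine {u} {v} u≢v u⟂v =
      (λ s t s∈ t∈ s≢t → ⟂⇒adjacent s≢t (collinear u≢v u⟂v (proj₁ (perp⁻ s∈)) (proj₂ (perp⁻ s∈))
                                          (proj₁ (perp⁻ t∈)) (proj₂ (perp⁻ t∈))))
    , (λ p p∉ adj → false≢true p∉ (perp⁺ (adjacent⇒⟂ (adj u (perp⁺ (⟂-refl u) u⟂v)))
                                         (adjacent⇒⟂ (adj v (perp⁺ (⟂-sym u⟂v) (⟂-refl v))))))

  -- Maximality excludes the empty set, to which every point is vacuously adjacent, and singletons,
  -- which can be enlarged in any direction. So M contains two points u and v. Their perp is a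
  -- clique containing M, and maximality gives equality.
  IsLine⇒perp : ∀ M → IsLine M → ∃[ u ] ∃[ v ] ¬ u ≡ v × u ⟂ v × (∀ z → M z ≡ perp u v z)
  IsLine⇒perp M (clique , maximal) with search M
  ... | inj₂ M≡∅ = contradiction (λ s s∈ → contradiction s∈ (false≢true (M≡∅ s))) (maximal 𝟘 (M≡∅ 𝟘))
  ... | inj₁ (u , u∈) with search (λ z → M z ∧ not (does (z ≟ₚ u)))
  ...   | inj₂ M≡u = contradiction adj (maximal v (Bool.¬-not λ v∈ → v≢u (only-u v∈)))
    where
    v : Point
    v = u ⊕ dir zero
    v≢u : ¬ v ≡ u
    v≢u eq = p≢p⊕dir u zero (sym eq)
    only-u : ∀ {z} → M z ≡ true → z ≡ u
    only-u {z} z∈ with z ≟ₚ u | M≡u z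
    ... | yes z≡u | _  = z≡u
    ... | no _    | eq = contradiction (trans (sym (Bool.∧-identityʳ (M z))) eq) (λ z∉ → false≢true z∉ z∈)
    adj : ∀ s → M s ≡ true → Adjacent v s
    adj s s∈ with refl ← only-u s∈ = ⟂⇒adjacent v≢u (p⊕dir⟂p u zero)
  ...   | inj₁ (v , v∈′) = u , v , u≢v , u⟂v , M≡perp
    where
    v∈ : M v ≡ true
    v∈ = proj₁ (∧-true⁻ v∈′)
    u≢v : ¬ u ≡ v
    u≢v refl = false≢true (cong not (dec-true (u ≟ₚ u) refl)) (proj₂ (∧-true⁻ {M u} v∈′))
    clique⟂ : ∀ {s t} → M s ≡ true → M t ≡ true → s ⟂ t
    clique⟂ {s} {t} s∈ t∈ with s ≟ₚ t
    ... | yes refl = ⟂-refl s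
    ... | no s≢t   = adjacent⇒⟂ (clique s t s∈ t∈ s≢t)
    u⟂v : u ⟂ v
    u⟂v = clique⟂ u∈ v∈
    M≡perp : ∀ z → M z ≡ perp u v z
    M≡perp z with M z in eq | perp u v z in z∈perp
    ... | true  | true  = refl
    ... | false | false = refl
    ... | true  | false = contradiction (perp⁺ (clique⟂ eq u∈) (clique⟂ eq v∈)) (false≢true z∈perp)
    ... | false | true  = contradiction (λ s s∈ → ⟂⇒adjacent (λ { refl → false≢true eq s∈ })
      (collinear u≢v u⟂v (proj₁ (perp⁻ z∈perp)) (proj₂ (perp⁻ z∈perp)) (clique⟂ s∈ u∈) (clique⟂ s∈ v∈)))
      (maximal z eq)

-- Two numerical inequalities.

-- With a = 2 + s and b = 2 + t, the number (a + b)(q + 2) - 2ab exceeds 4q by s(q - b) + t(q - a).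
-- The term 2ab stands on the right to avoid truncated subtraction.
quadrangle-bound : ∀ {a b q n VA VB} → 2 ≤ a → 2 ≤ b → a ≤ q → b ≤ q →
  a * suc q ≤ VA → b * suc q ≤ VB → VA + VB + (a + b) ≤ n + (a * b + b * a) → 4 * q ≤ n
quadrangle-bound {suc (suc s)} {suc (suc t)} {q} {n} {VA} {VB} (s≤s (s≤s _)) (s≤s (s≤s _)) a≤q b≤q a≤VA b≤VB sum≤ =
  ℕ.+-cancelʳ-≤ (a * b + b * a) (4 * q) n (begin
    4 * q + (a * b + b * a)                              ≡⟨ expandˡ s t q ⟩
    4 * q + (s * b + t * a) + (8 + 2 * s + 2 * t)        ≤⟨ ℕ.+-monoˡ-≤ _ (ℕ.+-monoʳ-≤ (4 * q)
                                                              (ℕ.+-mono-≤ (ℕ.*-monoʳ-≤ s b≤q) (ℕ.*-monoʳ-≤ t a≤q))) ⟩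
    4 * q + (s * q + t * q) + (8 + 2 * s + 2 * t)        ≡⟨ expandʳ s t q ⟩
    a * suc q + b * suc q + (a + b)                      ≤⟨ ℕ.+-monoˡ-≤ (a + b) (ℕ.+-mono-≤ a≤VA b≤VB) ⟩
    VA + VB + (a + b)                                    ≤⟨ sum≤ ⟩
    n + (a * b + b * a)                                  ∎)
  where
  open ℕ.≤-Reasoning
  a b : ℕ
  a = 2 + s
  b = 2 + t
  expandˡ : ∀ s t q → 4 * q + ((2 + s) * (2 + t) + (2 + t) * (2 + s)) ≡
                      4 * q + (s * (2 + t) + t * (2 + s)) + (8 + 2 * s + 2 * t)
  expandˡ = solve-∀
  expandʳ : ∀ s t q → 4 * q + (s * q + t * q) + (8 + 2 * s + 2 * t) ≡
                      (2 + s) * suc q + (2 + t) * suc q + (2 + s + (2 + t))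
  expandʳ = solve-∀

-- The difference is (q - 1)².
4q≤[1+q]² : ∀ {q} → 1 ≤ q → 4 * q ≤ suc q * suc q
4q≤[1+q]² {suc k} _ = subst (4 * suc k ≤_) (expand k) (ℕ.m≤m+n (4 * suc k) (k * k))
  where
  expand : ∀ k → 4 * suc k + k * k ≡ suc (suc k) * suc (suc k)
  expand = solve-∀

-- The lower bound for stopping sets.

module StoppingSets {q : ℕ} (F : FiniteField q) (1+1≡0 : Characteristic2 F) where

  open Geometry F 1+1≡0

  opaque
    adjᵇ : Point → Point → Bool
    adjᵇ u v = does (u ⟂? v) ∧ not (does (u ≟ₚ v))

    adjᵇ⁺ : ∀ {u v} → u ⟂ v → ¬ u ≡ v → adjᵇ u v ≡ true
    adjᵇ⁺ {u} {v} u⟂v u≢v = cong₂ _∧_ (dec-true (u ⟂? v) u⟂v) (cong not (dec-false (u ≟ₚ v) u≢v))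

    adjᵇ⁻ : ∀ {u v} → adjᵇ u v ≡ true → u ⟂ v × ¬ u ≡ v
    adjᵇ⁻ {u} {v} eq with u ⟂? v | u ≟ₚ v
    ... | yes u⟂v | no u≢v = u⟂v , u≢v

  -- The perp of a non-collinear pair has q + 1 points in the generalized
  -- quadrangle, one of which is missing here (it lies at infinity): it is
  -- parametrised by one of the diagonal entries.
  perp-size : ∀ {f : Subset} {x y} → ¬ x ⟂ y → (∀ {z} → f z ≡ true → z ⟂ x × z ⟂ y) → count f ≤ q
  perp-size {f} {x} {y} x⟂̸y f⊆ with entry₂₂ (y ⊕ x) Fin.≟ 0# | entry₁₁ (y ⊕ x) Fin.≟ 0#
  ... | no c≢0  | _ = count≤Fin f entry₂₂ λ {z} {w} fz fw eq → let z⟂x , z⟂y = f⊆ fz ; w⟂x , w⟂y = f⊆ fw in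
    ⊕-cancelʳ x (tangent-entry₂₂ {z ⊕ x} {w ⊕ x} {y ⊕ x} z⟂x w⟂x
      (trans (⟂⇒B x z⟂y z⟂x) (sym (⟂⇒B x w⟂y w⟂x))) c≢0 (cong (_⊹ entry₂₂ x) eq))
  ... | yes _   | no a≢0 = count≤Fin f entry₁₁ λ {z} {w} fz fw eq → let z⟂x , z⟂y = f⊆ fz ; w⟂x , w⟂y = f⊆ fw in
    ⊕-cancelʳ x (tangent-entry₁₁ {z ⊕ x} {w ⊕ x} {y ⊕ x} z⟂x w⟂x
      (trans (⟂⇒B x z⟂y z⟂x) (sym (⟂⇒B x w⟂y w⟂x))) a≢0 (cong (_⊹ entry₁₁ x) eq))
  -- Here a point z of the perp would give N (y ⊕ x) = B (z ⊕ x) (y ⊕ x) = 0, against the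
  -- non-collinearity of x and y. So f is empty and any map serves.
  ... | yes c≡0 | yes a≡0 = count≤Fin f entry₁₁ λ {z} fz _ _ → let z⟂x , z⟂y = f⊆ fz in
    contradiction (⟂-sym (trans (sym (⟂⇒B x z⟂y z⟂x)) (B-vertical (z ⊕ x) (y ⊕ x) a≡0 c≡0))) x⟂̸y

  module _ (T : Subset) (stopping : IsStoppingSet T) where

    opaque
      -- The stopping condition enters the bound here: the line through p in direction i meets T in
      -- p, hence in a second point.
      neighbour : ∀ {p} → T p ≡ true → ∀ i → ∃[ z ] ¬ z ≡ p × T z ≡ true × OnLine p i z
      neighbour {p} Tp i =
        let p⟂pi = ⟂-sym (p⊕dir⟂p p i)
            z , z≢p , eq = another (λ z → perp p (p ⊕ dir i) z ∧ T z)
              (stopping (perp p (p ⊕ dir i)) (perp-IsLine (p≢p⊕dir p i) p⟂pi))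
              (cong₂ _∧_ (perp⁺ (⟂-refl p) p⟂pi) Tp)
        in z , z≢p , proj₂ (∧-true⁻ {perp p (p ⊕ dir i) z} eq) , perp⁻ (proj₁ (∧-true⁻ eq))

    -- The opposite vertices are p, r and x, y. Their non-collinearity, together with the four
    -- sides, makes all four vertices distinct.
    record Quadrangle (p r x y : Point) : Set where
      field
        p⟂̸r : ¬ p ⟂ r
        x⟂̸y : ¬ x ⟂ y
        x⟂p : x ⟂ p
        x⟂r : x ⟂ r
        y⟂p : y ⟂ p
        y⟂r : y ⟂ r
        Tp  : T p ≡ true
        Tr  : T r ≡ true
        Tx  : T x ≡ true
        Ty  : T y ≡ true

    swap : ∀ {p r x y} → Quadrangle p r x y → Quadrangle x y p r
    swap Q = record
      { p⟂̸r = x⟂̸y ; x⟂̸y = p⟂̸r ; x⟂p = ⟂-sym x⟂p ; x⟂r = ⟂-sym y⟂p ; y⟂p = ⟂-sym x⟂r ; y⟂r = ⟂-sym y⟂r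
      ; Tp = Tx ; Tr = Ty ; Tx = Tp ; Ty = Tr }
      where open Quadrangle Q

    opaque
      perpT : Point → Point → Subset
      perpT x y z = T z ∧ perp x y z

      perpT⁺ : ∀ {x y z} → T z ≡ true → z ⟂ x → z ⟂ y → perpT x y z ≡ true
      perpT⁺ Tz z⟂x z⟂y = cong₂ _∧_ Tz (perp⁺ z⟂x z⟂y)

      perpT⁻ : ∀ {x y z} → perpT x y z ≡ true → T z ≡ true × z ⟂ x × z ⟂ y
      perpT⁻ {x} {y} {z} eq = proj₁ (∧-true⁻ eq) , perp⁻ (proj₂ (∧-true⁻ {T z} eq))

    neighboursIn : Subset → Point → ℕ
    neighboursIn S s = count λ b → S b ∧ adjᵇ s b

    opaque
      -- s is a T-neighbour of a whose line to a contains no point of T ∩ {p,r}^⟂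
      -- other than s; such neighbours are not shared between the two hyperbolic lines.
      escapes : Point → Point → Point → Point → Bool
      escapes p r a s = T s ∧ (adjᵇ s a ∧ does (neighboursIn (perpT p r) s ℕ.≟ 0))

      escapes⁺ : ∀ {p r a s} → T s ≡ true → s ⟂ a → ¬ s ≡ a →
                 (∀ {b} → perpT p r b ≡ true → ¬ b ≡ s → ¬ s ⟂ b) → escapes p r a s ≡ true
      escapes⁺ {p} {r} {a} {s} Ts s⟂a s≢a no-b = cong₂ _∧_ Ts (cong₂ _∧_ (adjᵇ⁺ s⟂a s≢a)
        (dec-true (neighboursIn (perpT p r) s ℕ.≟ 0) (count-none λ b → Bool.¬-not λ eq →
          let b∈ , s~b = ∧-true⁻ {perpT p r b} eq ; s⟂b , s≢b = adjᵇ⁻ s~b in no-b b∈ (s≢b ∘ sym) s⟂b)))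

      escapes⁻ : ∀ {p r a s} → escapes p r a s ≡ true →
                 T s ≡ true × s ⟂ a × ¬ s ≡ a × (∀ {b} → perpT p r b ≡ true → ¬ b ≡ s → ¬ s ⟂ b)
      escapes⁻ {p} {r} {a} {s} eq with ∧-true⁻ {T s} eq
      ... | Ts , eq′ with ∧-true⁻ {adjᵇ s a} eq′
      ...   | s~a , none = Ts , proj₁ (adjᵇ⁻ s~a) , proj₂ (adjᵇ⁻ s~a) , λ {b} b∈ b≢s s⟂b →
        false≢true (count-none⁻ (does-true (neighboursIn (perpT p r) s ℕ.≟ 0) none) b)
                   (cong₂ _∧_ b∈ (adjᵇ⁺ s⟂b (b≢s ∘ sym)))

    -- Set up for double counting the pairs (a, s) with a in A = T ∩ {x,y}^⟂ and s an escape from a: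
    -- this is the number of pairs with a given s.
    weight : Point → Point → Point → Point → Point → ℕ
    weight p r x y s = count λ a → perpT x y a ∧ escapes p r a s

    module _ {p r x y} (Q : Quadrangle p r x y) where
      open Quadrangle Q

      2≤perpT : 2 ≤ count (perpT x y)
      2≤perpT = injective⇒≤count {f = perpT x y} (λ { zero → p ; (suc zero) → r })
        (λ { {zero} {zero} _ → refl ; {suc zero} {suc zero} _ → refl
           ; {zero} {suc zero} p≡r → contradiction (subst (p ⟂_) p≡r (⟂-refl p)) p⟂̸r
           ; {suc zero} {zero} r≡p → contradiction (subst (_⟂ r) r≡p (⟂-refl r)) p⟂̸r })
        (λ { zero → perpT⁺ Tp (⟂-sym x⟂p) (⟂-sym y⟂p) ; (suc zero) → perpT⁺ Tr (⟂-sym x⟂r) (⟂-sym y⟂r) })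

      perpT≤q : count (perpT x y) ≤ q
      perpT≤q = perp-size x⟂̸y (proj₂ ∘ perpT⁻)

      -- Regularity: a is collinear with x and y, hence with every point collinear with p and r.
      cross : ∀ {a b} → perpT x y a ≡ true → perpT p r b ≡ true → b ⟂ a
      cross a∈ b∈ with _ , a⟂x , a⟂y ← perpT⁻ a∈ | _ , b⟂p , b⟂r ← perpT⁻ b∈ =
        regular p⟂̸r x⟂̸y x⟂p x⟂r (⟂-sym a⟂x) y⟂p y⟂r (⟂-sym a⟂y) b⟂p b⟂r

      disjoint : ∀ {z} → perpT x y z ≡ true → ¬ perpT p r z ≡ true
      disjoint {z} z∈A z∈B with _ , z⟂x , z⟂y ← perpT⁻ z∈A | _ , z⟂p , z⟂r ← perpT⁻ z∈B | z ≟ₚ p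
      ... | yes refl = p⟂̸r z⟂r
      ... | no z≢p   = noncollinear x⟂̸y z≢p z⟂x z⟂y (⟂-sym x⟂p) (⟂-sym y⟂p) z⟂p

      antichain : ∀ {a a′} → perpT x y a ≡ true → perpT x y a′ ≡ true → ¬ a ≡ a′ → ¬ a ⟂ a′
      antichain a∈ a′∈ a≢a′ with _ , a⟂x , a⟂y ← perpT⁻ a∈ | _ , a′⟂x , a′⟂y ← perpT⁻ a′∈ =
        noncollinear x⟂̸y a≢a′ a⟂x a⟂y a′⟂x a′⟂y

      -- Regularity with a, a′ in place of p, r: a point collinear with a and a′ is collinear with
      -- everything collinear with x and y, in particular with p and r.
      absorb : ∀ {a a′ s} → perpT x y a ≡ true → perpT x y a′ ≡ true → ¬ a ≡ a′ →
               T s ≡ true → s ⟂ a → s ⟂ a′ → perpT p r s ≡ true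
      absorb a∈ a′∈ a≢a′ Ts s⟂a s⟂a′ with _ , a⟂x , a⟂y ← perpT⁻ a∈ | _ , a′⟂x , a′⟂y ← perpT⁻ a′∈ =
        perpT⁺ Ts (go x⟂p y⟂p) (go x⟂r y⟂r)
        where
        go : ∀ {z} → x ⟂ z → y ⟂ z → _ ⟂ z
        go x⟂z y⟂z = regular (antichain a∈ a′∈ a≢a′) x⟂̸y (⟂-sym a⟂x) (⟂-sym a′⟂x) x⟂z
                       (⟂-sym a⟂y) (⟂-sym a′⟂y) y⟂z s⟂a s⟂a′

      -- If the line in direction i meets B = T ∩ {p,r}^⟂, the point of intersection serves, as no
      -- two points of B are collinear. Otherwise a second point s of T on the line serves: a point
      -- b of B collinear with s is also collinear with a by `cross`, so b would lie on the line.
      escape : ∀ {a} → perpT x y a ≡ true → ∀ i →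
               ∃[ s ] ¬ s ≡ a × OnLine a i s × escapes p r a s ≡ true
      escape {a} a∈ i with search (λ b → perpT p r b ∧ perp a (a ⊕ dir i) b)
      ... | inj₁ (b , eq) = b , b≢a , perp⁻ {a} (proj₂ (∧-true⁻ {perpT p r b} eq))
          , escapes⁺ (proj₁ (perpT⁻ b∈)) (cross a∈ b∈) b≢a
              (λ b′∈ b′≢b b⟂b′ → antichain-B b′∈ b′≢b b⟂b′)
        where
        b∈ : perpT p r b ≡ true
        b∈ = proj₁ (∧-true⁻ eq)
        b≢a : ¬ b ≡ a
        b≢a refl = disjoint a∈ b∈
        antichain-B : ∀ {b′} → perpT p r b′ ≡ true → ¬ b′ ≡ b → ¬ b ⟂ b′
        antichain-B b′∈ b′≢b with _ , b⟂p , b⟂r ← perpT⁻ b∈ | _ , b′⟂p , b′⟂r ← perpT⁻ b′∈ =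
          noncollinear p⟂̸r (b′≢b ∘ sym) b⟂p b⟂r b′⟂p b′⟂r
      ... | inj₂ no-b with s , s≢a , Ts , s∈line ← neighbour (proj₁ (perpT⁻ {x} a∈)) i =
        s , s≢a , s∈line , escapes⁺ Ts (proj₁ s∈line) s≢a λ {b} b∈ _ s⟂b →
          let b⟂a , b⟂ai = OnLine-extend {i = i} (s≢a ∘ sym) s∈line (cross a∈ b∈) (⟂-sym s⟂b) in
          false≢true (no-b b) (cong₂ _∧_ b∈ (perp⁺ b⟂a b⟂ai))

      -- One escape per direction; they are distinct because a point other than a lies on at most
      -- one line through a.
      1+q≤escapes : ∀ {a} → perpT x y a ≡ true → suc q ≤ count (escapes p r a)
      1+q≤escapes {a} a∈ = injective⇒≤count (λ i → proj₁ (escape a∈ i))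
        (λ {i} {j} eq → let s , s≢a , s∈i , _ = escape a∈ i ; _ , _ , s∈j , _ = escape a∈ j in
          OnLine-unique s≢a s∈i (subst (OnLine a j) (sym eq) s∈j))
        (λ i → proj₂ (proj₂ (proj₂ (escape a∈ i))))

      perpT*[1+q]≤weights : count (perpT x y) * suc q ≤ ∑ (weight p r x y)
      perpT*[1+q]≤weights = begin
        count (perpT x y) * suc q                                    ≡⟨ ∑-*ʳ (λ a → ind (perpT x y a)) (suc q) ⟨
        ∑ (λ a → ind (perpT x y a) * suc q)                          ≤⟨ ∑-mono row ⟩
        ∑ (λ a → ∑ λ s → ind (perpT x y a ∧ escapes p r a s))        ≡⟨ ∑-comm (λ a s → ind (perpT x y a ∧ escapes p r a s)) ⟩
        ∑ (weight p r x y)                                           ∎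
        where
        open ℕ.≤-Reasoning
        row : ∀ a → ind (perpT x y a) * suc q ≤ count (λ s → perpT x y a ∧ escapes p r a s)
        row a with perpT x y a in a∈
        ... | true  = subst (_≤ count (escapes p r a)) (sym (ℕ.*-identityˡ (suc q))) (1+q≤escapes a∈)
        ... | false = z≤n

      opaque
        weight-outside : ∀ {s} → T s ≡ false → weight p r x y s ≡ 0
        weight-outside {s} Ts≡false = count-none λ a → Bool.¬-not λ eq →
          false≢true Ts≡false (proj₁ (escapes⁻ {p} {r} {a} (proj₂ (∧-true⁻ {perpT x y a} eq))))

        weight≤ : ∀ s → weight p r x y s ≤ count (perpT x y)
        weight≤ s = count-mono λ eq → proj₁ (∧-true⁻ eq)

        weight≡0 : ∀ {s} → perpT x y s ≡ true → weight p r x y s ≡ 0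
        weight≡0 {s} s∈ = count-none λ a → Bool.¬-not λ eq →
          let a∈ , esc = ∧-true⁻ {perpT x y a} eq ; _ , s⟂a , s≢a , _ = escapes⁻ esc in
          antichain s∈ a∈ s≢a s⟂a

        -- Two distinct points of A collinear with s would force s into B by `absorb`.
        weight≤1 : ∀ {s} → perpT p r s ≡ false → weight p r x y s ≤ 1
        weight≤1 {s} s∉B = count≤1 λ {a} {a′} eq eq′ → case a ≟ₚ a′ of λ where
          (yes a≡a′) → a≡a′
          (no a≢a′) →
            let a∈ , esc = ∧-true⁻ {perpT x y a} eq ; Ts , s⟂a , _ = escapes⁻ esc
                a′∈ , esc′ = ∧-true⁻ {perpT x y a′} eq′ ; _ , s⟂a′ , _ = escapes⁻ esc′ in
            contradiction (absorb a∈ a′∈ a≢a′ Ts s⟂a s⟂a′) (false≢true s∉B)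

        -- An escape from a point of A is collinear with no point of B other than itself, whereas an
        -- escape from a point of B is collinear with such a point.
        weight-exclusive : ∀ s → weight p r x y s ≡ 0 ⊎ weight x y p r s ≡ 0
        weight-exclusive s with search (λ a → perpT x y a ∧ escapes p r a s)
        ... | inj₂ none = inj₁ (count-none none)
        ... | inj₁ (a , eq) = inj₂ (count-none λ b → Bool.¬-not λ eq′ →
          let a∈ , esc = ∧-true⁻ {perpT x y a} eq ; _ , _ , _ , no-b = escapes⁻ esc
              b∈ , esc′ = ∧-true⁻ {perpT p r b} eq′ ; _ , s⟂b , s≢b , _ = escapes⁻ esc′ in
          no-b b∈ (s≢b ∘ sym) s⟂b)

    -- The count, point by point. A point of A has first weight 0 and second weight at most b = |B|;
    -- a point of B, symmetrically, 0 and at most a = |A|; any other point of T has total weight at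
    -- most 1. Summation over s produces the term 2ab.
    weights≤ : ∀ {p r x y} → Quadrangle p r x y → ∀ s →
      weight p r x y s + weight x y p r s + (ind (perpT x y s) + ind (perpT p r s)) ≤
      ind (T s) + (ind (perpT x y s) * count (perpT p r) + ind (perpT p r s) * count (perpT x y))
    weights≤ {p} {r} {x} {y} Q s with T s in Ts | perpT x y s in s∈A | perpT p r s in s∈B
    ... | false | true  | _     = contradiction (proj₁ (perpT⁻ {x} {y} {s} s∈A)) (false≢true Ts)
    ... | false | false | true  = contradiction (proj₁ (perpT⁻ {p} {r} {s} s∈B)) (false≢true Ts)
    ... | false | false | false rewrite weight-outside Q Ts | weight-outside (swap Q) Ts = z≤n
    ... | true  | true  | true  = contradiction s∈B (disjoint Q s∈A)
    ... | true  | true  | false rewrite weight≡0 Q s∈A | ℕ.+-identityʳ (count (perpT p r)) | ℕ.+-identityʳ (count (perpT p r)) =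
      subst (_≤ 1 + count (perpT p r)) (ℕ.+-comm 1 _) (s≤s (weight≤ (swap Q) s))
    ... | true  | false | true  rewrite weight≡0 (swap Q) s∈B | ℕ.+-identityʳ (count (perpT x y)) | ℕ.+-identityʳ (weight p r x y s) =
      subst (_≤ 1 + count (perpT x y)) (ℕ.+-comm 1 _) (s≤s (weight≤ Q s))
    ... | true  | false | false with weight-exclusive Q s
    ...   | inj₁ ≡0 rewrite ≡0 | ℕ.+-identityʳ (weight x y p r s) = weight≤1 (swap Q) s∈A
    ...   | inj₂ ≡0 rewrite ≡0 | ℕ.+-identityʳ (weight p r x y s) | ℕ.+-identityʳ (weight p r x y s) = weight≤1 Q s∈B

    quadrangle⇒4q≤ : ∀ {p r x y} → Quadrangle p r x y → 4 * q ≤ count T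
    quadrangle⇒4q≤ {p} {r} {x} {y} Q = quadrangle-bound {a = a} {b = b} (2≤perpT Q) (2≤perpT (swap Q))
      (perpT≤q Q) (perpT≤q (swap Q)) (perpT*[1+q]≤weights Q) (perpT*[1+q]≤weights (swap Q)) (begin
        ∑ (weight p r x y) + ∑ (weight x y p r) + (a + b)
          ≡⟨ cong₂ _+_ (∑-distrib-+ (weight p r x y) (weight x y p r))
                       (∑-distrib-+ (ind ∘ perpT x y) (ind ∘ perpT p r)) ⟨
        ∑ (λ s → weight p r x y s + weight x y p r s) + ∑ (λ s → ind (perpT x y s) + ind (perpT p r s))
          ≡⟨ ∑-distrib-+ (λ s → weight p r x y s + weight x y p r s) (λ s → ind (perpT x y s) + ind (perpT p r s)) ⟨
        ∑ (λ s → weight p r x y s + weight x y p r s + (ind (perpT x y s) + ind (perpT p r s)))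
          ≤⟨ ∑-mono (weights≤ Q) ⟩
        ∑ (λ s → ind (T s) + (ind (perpT x y s) * b + ind (perpT p r s) * a))
          ≡⟨ ∑-distrib-+ (ind ∘ T) (λ s → ind (perpT x y s) * b + ind (perpT p r s) * a) ⟩
        count T + ∑ (λ s → ind (perpT x y s) * b + ind (perpT p r s) * a)
          ≡⟨ cong (count T +_) (∑-distrib-+ (λ s → ind (perpT x y s) * b) (λ s → ind (perpT p r s) * a)) ⟩
        count T + (∑ (λ s → ind (perpT x y s) * b) + ∑ (λ s → ind (perpT p r s) * a))
          ≡⟨ cong (count T +_) (cong₂ _+_ (∑-*ʳ (ind ∘ perpT x y) b) (∑-*ʳ (ind ∘ perpT p r) a)) ⟩
        count T + (a * b + b * a) ∎)
      where
      open ℕ.≤-Reasoning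
      a b : ℕ
      a = count (perpT x y)
      b = count (perpT p r)

    -- Points of T at distance at most two from a given one.

    module _ {p} (Tp : T p ≡ true) where

      first : Fin (suc q) → Point
      first i = proj₁ (neighbour Tp i)

      first≢p : ∀ i → ¬ first i ≡ p
      first≢p i = proj₁ (proj₂ (neighbour Tp i))

      T-first : ∀ i → T (first i) ≡ true
      T-first i = proj₁ (proj₂ (proj₂ (neighbour Tp i)))

      OnLine-first : ∀ i → OnLine p i (first i)
      OnLine-first i = proj₂ (proj₂ (proj₂ (neighbour Tp i)))

      first-noncollinear : ∀ {i j} → ¬ i ≡ j → ¬ first i ⟂ first j
      first-noncollinear {i} {j} i≢j ci⟂cj = i≢j (OnLine-unique (first≢p j)
        (OnLine-extend {i = i} (first≢p i ∘ sym) (OnLine-first i) (proj₁ (OnLine-first j)) (⟂-sym ci⟂cj))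
        (OnLine-first j))

      -- At `first i` the direction i leads back along the line to p, so the label (i , i) is given
      -- to `first i` itself. The remaining labels go to points reached along the q other lines,
      -- which makes (q + 1)² labels in all.
      Second : Fin (suc q) → Fin (suc q) → Point → Set
      Second i j s = (i ≡ j × s ≡ first i) ⊎ (¬ i ≡ j × ¬ s ≡ first i × OnLine (first i) j s)

      opaque
        second : ∀ i j → ∃[ s ] T s ≡ true × Second i j s
        second i j with i Fin.≟ j
        ... | yes i≡j = first i , T-first i , inj₁ (i≡j , refl)
        ... | no i≢j  = let s , s≢c , Ts , on = neighbour (T-first i) j in s , Ts , inj₂ (i≢j , s≢c , on)

      -- A point reached through two different neighbours of p closes a quadrangle. Other
      -- coincidences are impossible: a point has one direction as seen from `first i`, and distinct
      -- first neighbours are not collinear.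
      second-collision : ∀ {i j i′ j′ s} → ¬ (i , j) ≡ (i′ , j′) → T s ≡ true → Second i j s → Second i′ j′ s →
                         ∃₂ λ x y → Quadrangle p s x y
      second-collision {i} {i′ = i′} ij≢ Ts σ σ′ with i Fin.≟ i′
      second-collision ij≢ Ts (inj₁ (refl , _)) (inj₁ (refl , _)) | yes refl = contradiction refl ij≢
      second-collision ij≢ Ts (inj₁ (_ , s≡c)) (inj₂ (_ , s≢c , _)) | yes refl = contradiction s≡c s≢c
      second-collision ij≢ Ts (inj₂ (_ , s≢c , _)) (inj₁ (_ , s≡c)) | yes refl = contradiction s≡c s≢c
      second-collision {i} ij≢ Ts (inj₂ (_ , s≢c , on)) (inj₂ (_ , _ , on′)) | yes refl =
        contradiction (cong (i ,_) (OnLine-unique s≢c on on′)) ij≢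
      second-collision {i} {i′ = i′} ij≢ Ts (inj₁ (_ , s≡c)) (inj₁ (_ , s≡c′)) | no i≢i′ =
        contradiction (subst (_⟂ first i′) (trans (sym s≡c′) s≡c) (⟂-refl (first i′))) (first-noncollinear i≢i′)
      second-collision {i} {i′ = i′} ij≢ Ts (inj₁ (_ , s≡c)) (inj₂ (_ , _ , on′)) | no i≢i′ =
        contradiction (subst (_⟂ first i′) s≡c (proj₁ on′)) (first-noncollinear i≢i′)
      second-collision {i} {i′ = i′} ij≢ Ts (inj₂ (_ , _ , on)) (inj₁ (_ , s≡c′)) | no i≢i′ =
        contradiction (subst (_⟂ first i) s≡c′ (proj₁ on)) (first-noncollinear (i≢i′ ∘ sym))
      second-collision {i} {j} {i′} {s = s} ij≢ Ts (inj₂ (i≢j , _ , on)) (inj₂ (_ , _ , on′)) | no i≢i′ =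
        first i , first i′ , record
          { p⟂̸r = noncollinear (first-noncollinear i≢i′) p≢s (⟂-sym c⟂p) (⟂-sym c′⟂p) (proj₁ on) (proj₁ on′)
          ; x⟂̸y = first-noncollinear i≢i′
          ; x⟂p = c⟂p ; x⟂r = ⟂-sym (proj₁ on) ; y⟂p = c′⟂p ; y⟂r = ⟂-sym (proj₁ on′)
          ; Tp = Tp ; Tr = Ts ; Tx = T-first i ; Ty = T-first i′ }
        where
        c⟂p : first i ⟂ p
        c⟂p = proj₁ (OnLine-first i)
        c′⟂p : first i′ ⟂ p
        c′⟂p = proj₁ (OnLine-first i′)
        p≢s : ¬ p ≡ s
        -- From `first i`, the point p lies in direction i but s lies in direction j ≠ i.
        p≢s p≡s = i≢j (OnLine-unique (first≢p i ∘ sym) (OnLine-sym {p} {i} (OnLine-first i))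
                         (subst (OnLine (first i) j) (sym p≡s) on))

      -- If |T| < 4q ≤ (q + 1)², two labels share a point by the pigeonhole principle, and the
      -- resulting quadrangle forces 4q ≤ |T| after all.
      4q≤count : 4 * q ≤ count T
      4q≤count = ℕ.≮⇒≥ λ n<4q →
        let k , l , k≢l , eq = collision {f = T} (ℕ.<-≤-trans n<4q (4q≤[1+q]² (ℕ.≤-trans (s≤s z≤n) (Fin.toℕ<n 0#))))
                                 (λ k → proj₁ (point k)) (λ k → proj₁ (proj₂ (point k)))
            _ , _ , Q = second-collision {proj₁ (pair k)} {proj₂ (pair k)} {proj₁ (pair l)} {proj₂ (pair l)}
                          (λ ij≡ → k≢l (trans (sym (Fin.combine-remQuot {suc q} (suc q) k))
                            (trans (cong (λ (i , j) → combine i j) ij≡) (Fin.combine-remQuot {suc q} (suc q) l))))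
                          (proj₁ (proj₂ (point k))) (proj₂ (proj₂ (point k)))
                          (subst (Second (proj₁ (pair l)) (proj₂ (pair l))) (sym eq) (proj₂ (proj₂ (point l))))
        in ℕ.<⇒≱ n<4q (quadrangle⇒4q≤ Q)
        where
        pair : Fin (suc q * suc q) → Fin (suc q) × Fin (suc q)
        pair = remQuot {suc q} (suc q)
        point : ∀ k → ∃[ s ] T s ≡ true × Second (proj₁ (pair k)) (proj₂ (pair k)) s
        point k = second (proj₁ (pair k)) (proj₂ (pair k))

-- Translating by 1 permutes the field, so comparing the sums of all elements
-- gives 2ᵐ·1 = 0, that is 2ᵐ = 0 in F.
characteristic-2 : ∀ m (F : FiniteField (2 ^ m)) → Characteristic2 F
characteristic-2 m F = trans (cong (1# ⊹_) (sym (+-identityʳ 1#))) (2×1≡0 m 2^m×1≡0)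
  where
  open FieldProperties F
  open CommutativeRing commutativeRing using (semiring; +-commutativeMonoid; +-group)
  open Mult semiring using (×1-homo-*) renaming (_×_ to _×ₙ_)
  open Sum +-commutativeMonoid using (sum-permute; sum-replicate; ∑-distrib-+) renaming (sum to ∑F)
  open GroupProperties +-group using (identityʳ-unique)

  x-1+1 : ∀ x → x ⊹ (- 1#) ⊹ 1# ≡ x
  x-1+1 x = trans (+-assoc x (- 1#) 1#) (trans (cong (x ⊹_) (-‿inverseˡ 1#)) (+-identityʳ x))

  x+1-1 : ∀ x → x ⊹ 1# ⊹ (- 1#) ≡ x
  x+1-1 x = trans (+-assoc x 1# (- 1#)) (trans (cong (x ⊹_) (-‿inverseʳ 1#)) (+-identityʳ x))

  2^m×1≡0 : (2 ^ m) ×ₙ 1# ≡ 0#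
  2^m×1≡0 = trans (sym (sum-replicate (2 ^ m))) (identityʳ-unique (∑F (λ x → x)) (∑F (λ (_ : Fin (2 ^ m)) → 1#))
    (trans (sym (∑-distrib-+ (λ x → x) (λ (_ : Fin (2 ^ m)) → 1#)))
           (sym (sum-permute (λ x → x) (permutation (_⊹ 1#) (_⊹ (- 1#)) x-1+1 x+1-1)))))

  -- If 2 were nonzero, the factors 2 could be cancelled one by one, until 1 = 0 remains.
  2×1≡0 : ∀ k → (2 ^ k) ×ₙ 1# ≡ 0# → 2 ×ₙ 1# ≡ 0#
  2×1≡0 zero    eq = contradiction (trans (sym eq) (+-identityʳ 1#)) 0≢1
  2×1≡0 (suc k) eq with 2 ×ₙ 1# Fin.≟ 0#
  ... | yes 2≡0 = 2≡0
  ... | no 2≢0  = 2×1≡0 k (·-cancelˡ-0 2≢0 (trans (sym (×1-homo-* 2 (2 ^ k))) eq))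

-- A codeword of weight 4q.

module Codeword {q : ℕ} (F : FiniteField q) (1+1≡0 : Characteristic2 F) where

  open Geometry F 1+1≡0
  open StoppingSets F 1+1≡0

  bit? : Fin q → Bool
  bit? x = does (x Fin.≟ 0#) ∨ does (x Fin.≟ 1#)

  bit?⁺ : ∀ {x} → x ≡ 0# ⊎ x ≡ 1# → bit? x ≡ true
  bit?⁺ {x} (inj₁ x≡0) = cong (_∨ does (x Fin.≟ 1#)) (dec-true (x Fin.≟ 0#) x≡0)
  bit?⁺ {x} (inj₂ x≡1) = trans (cong (does (x Fin.≟ 0#) ∨_) (dec-true (x Fin.≟ 1#) x≡1)) (Bool.∨-zeroʳ _)

  bit?⁻ : ∀ {x} → bit? x ≡ true → x ≡ 0# ⊎ x ≡ 1#
  bit?⁻ {x} eq with x Fin.≟ 0# | x Fin.≟ 1#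
  ... | yes x≡0 | _       = inj₁ x≡0
  ... | no _    | yes x≡1 = inj₂ x≡1

  bit?-+1 : ∀ {x} → bit? x ≡ true → bit? (x ⊹ 1#) ≡ true
  bit?-+1 {x} eq with bit?⁻ {x} eq
  ... | inj₁ refl = bit?⁺ (inj₂ (+-identityˡ 1#))
  ... | inj₂ refl = bit?⁺ (inj₁ 1+1≡0)

  toBit : Fin q → Fin 2
  toBit x = case x Fin.≟ 0# of λ where
    (yes _) → zero
    (no _)  → suc zero

  toBit-injective : ∀ {x y} → bit? x ≡ true → bit? y ≡ true → toBit x ≡ toBit y → x ≡ y
  toBit-injective {x} {y} bx by eq with x Fin.≟ 0# | y Fin.≟ 0# | bit?⁻ {x} bx | bit?⁻ {y} by
  ... | yes refl | yes refl | _         | _         = refl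
  ... | no x≢0   | no y≢0   | inj₂ refl | inj₂ refl = refl
  ... | no x≢0   | no y≢0   | inj₁ x≡0  | _         = contradiction x≡0 x≢0
  ... | no x≢0   | no y≢0   | inj₂ _    | inj₁ y≡0  = contradiction y≡0 y≢0

  -- Additive in characteristic 2, and zero on the vectors (y², y, 1).
  shear : Point → Fin q
  shear (a , b , _) = a ⊹ b · b

  -- The union of two pairs of perpendicular hyperbolic lines, with q points each.
  codeword : Subset
  codeword z = bit? (entry₂₂ z) ∧ bit? (shear z)

  shear-shift₁ : ∀ z → shear (z ⊕ (1# , 0# , 0#)) ≡ shear z ⊹ 1#
  shear-shift₁ (a , b , _) = solve 2 (λ a b →
    a :+ con true :+ (b :+ con false) :* (b :+ con false) := a :+ b :* b :+ con true) refl a b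

  shear-shift₂ : ∀ y z → shear (z ⊕ (y · y , y , 1#)) ≡ shear z
  shear-shift₂ y (a , b , _) = solve 3 (λ a b y →
    a :+ y :* y :+ (b :+ y) :* (b :+ y) := a :+ b :* b) refl a b y

  -- Two choices each for c and a + b² and q choices for b determine the point.
  codeword≤4q : count codeword ≤ 4 * q
  codeword≤4q = subst (count codeword ≤_) (sym (ℕ.*-assoc 2 2 q)) (count≤Fin codeword
    (λ z → combine (toBit (entry₂₂ z)) (combine (toBit (shear z)) (proj₁ (proj₂ z)))) coordinates-injective)
    where
    coordinates-injective : ∀ {z w} → codeword z ≡ true → codeword w ≡ true → _ ≡ _ → z ≡ w
    coordinates-injective {a , b , c} {a′ , b′ , c′} z∈ w∈ eq
      with c-eq , ab-eq ← Fin.combine-injective (toBit c) (combine (toBit (a ⊹ b · b)) b)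
                                                 (toBit c′) (combine (toBit (a′ ⊹ b′ · b′)) b′) eq
      with s-eq , refl ← Fin.combine-injective (toBit (a ⊹ b · b)) b (toBit (a′ ⊹ b′ · b′)) b′ ab-eq
      = point≡ (+-cancelʳ (b · b) (toBit-injective (proj₂ (∧-true⁻ {bit? c} z∈)) (proj₂ (∧-true⁻ {bit? c′} w∈)) s-eq))
               refl (toBit-injective (proj₁ (∧-true⁻ z∈)) (proj₁ (∧-true⁻ w∈)) c-eq)

  -- Translation by w exchanges the part of f where g = 0 with the part where g = 1, so the two have
  -- the same size.
  even-count : ∀ (f : Subset) (g : Point → Fin q) w → (∀ {z} → f z ≡ true → f (z ⊕ w) ≡ true) →
               (∀ {z} → f z ≡ true → bit? (g z) ≡ true) → (∀ z → g (z ⊕ w) ≡ g z ⊹ 1#) →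
               odd (count f) ≡ false
  even-count f g w f-shift g-bit g-shift = trans (cong odd count≡) (odd-double (count f₀))
    where
    f₀ f₁ : Subset
    f₀ z = f z ∧ does (g z Fin.≟ 0#)
    f₁ z = f z ∧ does (g z Fin.≟ 1#)
    f₀⇒f₁ : ∀ {z} → f₀ z ≡ true → f₁ (z ⊕ w) ≡ true
    f₀⇒f₁ {z} eq = let fz , gz = ∧-true⁻ {f z} eq in cong₂ _∧_ (f-shift fz) (dec-true (g (z ⊕ w) Fin.≟ 1#)
      (trans (g-shift z) (trans (cong (_⊹ 1#) (does-true (g z Fin.≟ 0#) gz)) (+-identityˡ 1#))))
    f₁⇒f₀ : ∀ {z} → f₁ z ≡ true → f₀ (z ⊕ w) ≡ true
    f₁⇒f₀ {z} eq = let fz , gz = ∧-true⁻ {f z} eq in cong₂ _∧_ (f-shift fz) (dec-true (g (z ⊕ w) Fin.≟ 0#)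
      (trans (g-shift z) (trans (cong (_⊹ 1#) (does-true (g z Fin.≟ 1#) gz)) 1+1≡0)))
    split : ∀ z → ind (f z) ≡ ind (f₀ z) + ind (f₁ z)
    split z with f z in fz
    ... | false = refl
    ... | true with g z Fin.≟ 0# | g z Fin.≟ 1# | bit?⁻ {g z} (g-bit fz)
    ...   | yes g≡0 | yes g≡1 | _        = contradiction (trans (sym g≡0) g≡1) 0≢1
    ...   | yes _   | no _    | _        = refl
    ...   | no _    | yes _   | _        = refl
    ...   | no g≢0  | no _    | inj₁ g≡0 = contradiction g≡0 g≢0
    ...   | no _    | no g≢1  | inj₂ g≡1 = contradiction g≡1 g≢1
    count≡ : count f ≡ count f₀ + count f₀
    count≡ = trans (∑-cong split) (trans (∑-distrib-+ (ind ∘ f₀) (ind ∘ f₁)) (cong (count f₀ +_) (ℕ.≤-antisym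
      (count≤count f₁ f₀ (_⊕ w) (⊕-cancelʳ w) f₁⇒f₀) (count≤count f₀ f₁ (_⊕ w) (⊕-cancelʳ w) f₀⇒f₁))))

  -- In the expansion of N (z ⊕ u ⊕ w) the polar term vanishes, because z ⊕ u and w are both
  -- orthogonal to the isotropic vector v ⊕ u.
  perp-shift : ∀ {u v w z} → ¬ u ≡ v → u ⟂ v → N w ≡ 0# → B w (v ⊕ u) ≡ 0# → z ⟂ u → z ⟂ v → (z ⊕ w) ⟂ u
  perp-shift {u} {v} {w} {z} u≢v u⟂v Nw Bw z⟂u z⟂v = begin
    N (z ⊕ w ⊕ u)                    ≡⟨ cong N (trans (⊕-assoc z w u) (trans (cong (z ⊕_) (⊕-comm w u)) (sym (⊕-assoc z u w)))) ⟩
    N (z ⊕ u ⊕ w)                    ≡⟨ N-⊕ (z ⊕ u) w ⟩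
    N (z ⊕ u) ⊹ N w ⊹ B (z ⊕ u) w    ≡⟨ cong₂ _⊹_ (cong₂ _⊹_ z⟂u Nw) (isotropic-B {v ⊕ u} {z ⊕ u} {w}
                                          (λ eq → u≢v (sym (u⊕v≡𝟘⇒u≡v eq))) (⟂-sym u⟂v)
                                          (trans (⟂⇒B u z⟂v z⟂u) (⟂-sym u⟂v)) Bw) ⟩
    0# ⊹ 0# ⊹ 0#                     ≡⟨ trans (+-identityʳ _) (+-identityˡ 0#) ⟩
    0#                               ∎
    where open ≡-Reasoning

  -- For distinct collinear u and v these w are the scalar multiples of v ⊕ u, that is, the
  -- translations along the line.
  Period : Point → Point → Point → Set
  Period u v w = N w ≡ 0# × B w (v ⊕ u) ≡ 0#

  perp-periodic : ∀ {u v w z} → ¬ u ≡ v → u ⟂ v → Period u v w → perp u v z ≡ true → perp u v (z ⊕ w) ≡ true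
  perp-periodic {u} {v} {w} {z} u≢v u⟂v (Nw , Bw) z∈ with z⟂u , z⟂v ← perp⁻ z∈ = perp⁺
    (perp-shift {w = w} {z} u≢v u⟂v Nw Bw z⟂u z⟂v)
    (perp-shift {w = w} {z} (u≢v ∘ sym) (⟂-sym u⟂v) Nw (trans (cong (B w) (⊕-comm u v)) Bw) z⟂v z⟂u)

  -- Each line has a direction of one of the two shapes: the first changes `shear` by 1 and fixes
  -- the last entry, the second changes the last entry by 1 and fixes `shear`.
  period : ∀ {u v} → u ⟂ v → Period u v (1# , 0# , 0#) ⊎ (∃[ y ] Period u v (y · y , y , 1#))
  period {u} {v} u⟂v = from (v ⊕ u) (⟂-sym u⟂v)
    where
    from : ∀ e → N e ≡ 0# → (N (1# , 0# , 0#) ≡ 0# × B (1# , 0# , 0#) e ≡ 0#)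
                            ⊎ (∃[ y ] N (y · y , y , 1#) ≡ 0# × B (y · y , y , 1#) e ≡ 0#)
    from (a , b , c) Ne with c Fin.≟ 0#
    ... | yes c≡0 = inj₁
      ( solve 0 (con true :* con false :+ con false :* con false := con false) refl
      , trans (solve 2 (λ a c → con true :* c :+ a :* con false := c) refl a c) c≡0 )
    -- Scaling (a, b, c) by 1/c gives (y², y, 1) with y = b/c, since ac = b².
    ... | no c≢0 with c⁻¹ , cc⁻¹≡1 ← inverse c c≢0 = inj₂ (b · c⁻¹ ,
        solve 1 (λ y → y :* y :* con true :+ y :* y := con false) refl (b · c⁻¹)
      , ·-cancelˡ-0 c≢0 (begin
          c · (b · c⁻¹ · (b · c⁻¹) · c ⊹ a · 1#)   ≡⟨ solve 4 (λ a b c c⁻¹ →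
            c :* (b :* c⁻¹ :* (b :* c⁻¹) :* c :+ a :* con true) := a :* c :+ b :* b :* (c :* c⁻¹ :* (c :* c⁻¹))) refl a b c c⁻¹ ⟩
          a · c ⊹ b · b · (c · c⁻¹ · (c · c⁻¹))    ≡⟨ cong (λ x → a · c ⊹ b · b · (x · x)) cc⁻¹≡1 ⟩
          a · c ⊹ b · b · (1# · 1#)                ≡⟨ solve 3 (λ a b c →
            a :* c :+ b :* b :* (con true :* con true) := a :* c :+ b :* b) refl a b c ⟩
          N (a , b , c)                            ≡⟨ Ne ⟩
          0#                                       ∎))
      where open ≡-Reasoning

  codeword-shift₁ : ∀ {z} → codeword z ≡ true → codeword (z ⊕ (1# , 0# , 0#)) ≡ true
  codeword-shift₁ {z} z∈ = let c∈ , s∈ = ∧-true⁻ {bit? (entry₂₂ z)} z∈ in cong₂ _∧_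
    (trans (cong bit? (+-identityʳ (entry₂₂ z))) c∈) (trans (cong bit? (shear-shift₁ z)) (bit?-+1 s∈))

  codeword-shift₂ : ∀ y {z} → codeword z ≡ true → codeword (z ⊕ (y · y , y , 1#)) ≡ true
  codeword-shift₂ y {z} z∈ = let c∈ , s∈ = ∧-true⁻ {bit? (entry₂₂ z)} z∈ in cong₂ _∧_
    (bit?-+1 c∈) (trans (cong bit? (shear-shift₂ y z)) s∈)

  perp∩codeword-even : ∀ {u v} → ¬ u ≡ v → u ⟂ v → odd (count λ z → perp u v z ∧ codeword z) ≡ false
  perp∩codeword-even {u} {v} u≢v u⟂v with period u⟂v
  ... | inj₁ w = even-count (λ z → perp u v z ∧ codeword z) shear (1# , 0# , 0#)
    (λ {z} eq → let z∈ , cz = ∧-true⁻ {perp u v z} eq in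
      cong₂ _∧_ (perp-periodic u≢v u⟂v w z∈) (codeword-shift₁ {z} cz))
    (λ {z} eq → proj₂ (∧-true⁻ {bit? (entry₂₂ z)} (proj₂ (∧-true⁻ {perp u v z} eq)))) shear-shift₁
  ... | inj₂ (y , w) = even-count (λ z → perp u v z ∧ codeword z) entry₂₂ (y · y , y , 1#)
    (λ {z} eq → let z∈ , cz = ∧-true⁻ {perp u v z} eq in
      cong₂ _∧_ (perp-periodic u≢v u⟂v w z∈) (codeword-shift₂ y {z} cz))
    (λ {z} eq → proj₁ (∧-true⁻ {bit? (entry₂₂ z)} (proj₂ (∧-true⁻ {perp u v z} eq)))) (λ _ → refl)

  codeword-InCode : InCode codeword
  codeword-InCode M M-line = let u , v , u≢v , u⟂v , M≡perp = IsLine⇒perp M M-line in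
    trans (foldr-xor≡odd (λ z → M z ∧ codeword z)) (trans
      (cong odd (∑-cong λ z → cong (λ b → ind (b ∧ codeword z)) (M≡perp z))) (perp∩codeword-even u≢v u⟂v))

  InCode⇒stopping : ∀ {c} → InCode c → IsStoppingSet c
  InCode⇒stopping {c} c∈ M M-line size≡1 =
    false≢true (c∈ M M-line) (trans (foldr-xor≡odd (λ z → M z ∧ c z)) (cong odd size≡1))

  codeword-nonempty : NonEmpty codeword
  codeword-nonempty = 𝟘 , cong₂ _∧_ (bit?⁺ (inj₁ refl))
    (bit?⁺ (inj₁ (solve 0 (con false :+ con false :* con false := con false) refl)))

  -- The lower bound is the general one for stopping sets, applied to the codeword itself.
  codeword-size : count codeword ≡ 4 * q
  codeword-size = ℕ.≤-antisym codeword≤4q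
    (4q≤count codeword (InCode⇒stopping codeword-InCode) {𝟘} (proj₂ codeword-nonempty))

  minimumDistance : MinimumDistanceIs (4 * q)
  minimumDistance = (codeword , codeword-InCode , codeword-nonempty , codeword-size)
    , λ c c∈ (_ , cp) → 4q≤count c (InCode⇒stopping c∈) cp

  stoppingDistance : StoppingDistanceIs (4 * q)
  stoppingDistance = (codeword , InCode⇒stopping codeword-InCode , codeword-nonempty , codeword-size)
    , λ T stopping (_ , Tp) → 4q≤count T stopping Tp

theorem5 : (m : ℕ) (F : FiniteField (2 ^ m)) →
    SymmetricMatrices.MinimumDistanceIs F (4 * 2 ^ m)
    × SymmetricMatrices.StoppingDistanceIs F (4 * 2 ^ m)
theorem5 m F = minimumDistance , stoppingDistance
  where open Codeword F (characteristic-2 m F)
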